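{- Let $A_2(n;k,\ell,m)$ be the number of finite sequences $\lambda_1,\dots,\lambda_s$ of coloured positive integers with $\sum\lambda_i=n$, where odd parts are coloured $a$ or $d$, even parts are coloured $b$ or $c$, there is no part $1_d$, and $\lambda_i-\lambda_{i+1}\ge B_2(\text{colour of }\lambda_i,\text{colour of }\lambda_{i+1})$ for all $1\le i<s$, having $k$ parts coloured $a$, $\ell$ parts coloured $c$ and $m$ parts coloured $d$. Then $$\sum_{n,k,\ell,m\ge0}A_2(n;k,\ell,m)\,q^n a^k c^\ell d^m=\frac{(-aq;q^4)_\infty(-dq^3;q^4)_\infty}{(q^2;q^2)_\infty(cq^2;q^4)_\infty}.$$ In particular (setting $a=c=d=1$) the generating function of all such coloured partitions is $1/(q;q)_\infty$.
   Context: Notation: $(x;q)_\infty=\prod_{n\ge0}(1-xq^n)$. $B_2$ is the matrix with rows and columns indexed by $(a,b,c,d)$: row $a$: $(4,1,3,2)$; row $b$: $(3,0,2,1)$; row $c$: $(1,2,0,3)$; row $d$: $(2,3,1,4)$. -}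

module Defs where

open import Algebra.Bundles using (CommutativeRing)
import Algebra.Construct.Pointwise as Pointwise
import Algebra.Properties.CommutativeSemigroup as CommutativeSemigroupProperties
import Algebra.Properties.Ring as RingProperties
import Algebra.Properties.Semiring.Exp as Exp
open import Data.Integer.Properties using (+-*-commutativeRing)
open import Data.List.Base using (List; []; _∷_; length; map; filter; upTo; cartesianProductWith)
open import Data.List.Membership.Propositional using (_∈_)
open import Data.List.Membership.Propositional.Properties using (∈-filter⁺; ∈-filter⁻; ∈-cartesianProductWith⁺; ∈-cartesianProductWith⁻; ∈-upTo⁺)
open import Data.List.Properties using (∷-injective)
open import Data.List.Relation.Unary.All as All using (All; []; _∷_; all?)
open import Data.List.Relation.Unary.Any using (here; there)
open import Data.List.Relation.Unary.AllPairs using ([]; _∷_)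
open import Data.List.Relation.Unary.Linked using (Linked; linked?)
open import Data.List.Relation.Unary.Unique.Propositional using (Unique)
open import Data.List.Relation.Unary.Unique.Propositional.Properties using (filter⁺; cartesianProductWith⁺; upTo⁺)
open import Data.Nat.Base as ℕ using (ℕ; zero; suc; z≤n; s≤s)
open import Data.Nat.Divisibility using (_∣_; _∤_; _∣?_)
open import Data.Nat.ListAction using (sum)
import Data.Nat.Properties as ℕ
open import Data.Product.Base using (_×_; _,_; proj₁; proj₂; uncurry)
open import Function.Base using (_∘_)
open import Level using (Level)
open import Relation.Binary.Definitions using (DecidableEquality)
open import Relation.Binary.PropositionalEquality using (_≡_; _≢_; refl; cong; cong₂)
open import Relation.Nullary using (Dec; yes; no; ¬?; map′; _×-dec_)
open import Relation.Unary using (Decidable)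

-- Formal power series over a commutative ring, f n being the
-- coefficient of Xⁿ

module PowerSeries {c ℓ : Level} (R : CommutativeRing c ℓ) where

  private
    module R = CommutativeRing R
    module RP = RingProperties R.ring
    module RS = CommutativeSemigroupProperties R.+-commutativeSemigroup
    module P = Pointwise ℕ
    open import Relation.Binary.Reasoning.Setoid R.setoid

    Series : Set c
    Series = ℕ → R.Carrier

    infix 4 _≐_
    _≐_ : Series → Series → Set ℓ
    f ≐ g = ∀ n → f n R.≈ g n

    tail : Series → Series
    tail f n = f (suc n)

  const : R.Carrier → Series
  const r zero    = r
  const r (suc n) = R.0#

  X : Series
  X zero    = R.0#
  X (suc n) = const R.1# n

  private
    infixl 7 _⊛_
    infixl 6 _⊕_
    _⊕_ : Series → Series → Series
    (f ⊕ g) n = f n R.+ g n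

    -- The Cauchy product Σ_{i ≤ n} f i · g (n - i), with the term i = 0
    -- split off.
    _⊛_ : Series → Series → Series
    (f ⊛ g) zero    = f zero R.* g zero
    (f ⊛ g) (suc n) = f zero R.* g (suc n) R.+ (tail f ⊛ g) n

    ⊛-cong≤ : ∀ {f f′ g g′} n → f ≐ f′ → (∀ i → i ℕ.≤ n → g i R.≈ g′ i) → (f ⊛ g) n R.≈ (f′ ⊛ g′) n
    ⊛-cong≤ zero    p q = R.*-cong (p 0) (q 0 z≤n)
    ⊛-cong≤ (suc n) p q = R.+-cong (R.*-cong (p 0) (q (suc n) ℕ.≤-refl))
                                   (⊛-cong≤ n (p ∘ suc) (λ i i≤n → q i (ℕ.m≤n⇒m≤1+n i≤n)))

    ⊛-cong : ∀ {f f′ g g′} → f ≐ f′ → g ≐ g′ → f ⊛ g ≐ f′ ⊛ g′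
    ⊛-cong p q n = ⊛-cong≤ n p (λ i _ → q i)

    ⊛-distribʳ : ∀ h f g → (f ⊕ g) ⊛ h ≐ f ⊛ h ⊕ g ⊛ h
    ⊛-distribʳ h f g zero    = R.distribʳ _ _ _
    ⊛-distribʳ h f g (suc n) = R.trans
      (R.+-cong (R.distribʳ _ _ _) (⊛-distribʳ h (tail f) (tail g) n)) (RS.interchange _ _ _ _)

    ⊛-scaleˡ : ∀ r f g → (λ n → r R.* f n) ⊛ g ≐ (λ n → r R.* (f ⊛ g) n)
    ⊛-scaleˡ r f g zero    = R.*-assoc _ _ _
    ⊛-scaleˡ r f g (suc n) = R.trans
      (R.+-cong (R.*-assoc _ _ _) (⊛-scaleˡ r (tail f) g n)) (R.sym (R.distribˡ _ _ _))

    ⊛-assoc : ∀ f g h → (f ⊛ g) ⊛ h ≐ f ⊛ (g ⊛ h)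
    ⊛-assoc f g h zero    = R.*-assoc _ _ _
    ⊛-assoc f g h (suc n) = begin
      f 0 R.* g 0 R.* h (suc n) R.+ (tail (f ⊛ g) ⊛ h) n
        ≈⟨ R.+-cong (R.*-assoc _ _ _) (⊛-distribʳ h (λ k → f 0 R.* tail g k) (tail f ⊛ g) n) ⟩
      f 0 R.* (g 0 R.* h (suc n)) R.+ (((λ k → f 0 R.* tail g k) ⊛ h) n R.+ ((tail f ⊛ g) ⊛ h) n)
        ≈⟨ R.+-congˡ (R.+-cong (⊛-scaleˡ (f 0) (tail g) h n) (⊛-assoc (tail f) g h n)) ⟩
      f 0 R.* (g 0 R.* h (suc n)) R.+ (f 0 R.* (tail g ⊛ h) n R.+ (tail f ⊛ (g ⊛ h)) n)
        ≈⟨ R.sym (R.+-assoc _ _ _) ⟩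
      f 0 R.* (g 0 R.* h (suc n)) R.+ f 0 R.* (tail g ⊛ h) n R.+ (tail f ⊛ (g ⊛ h)) n
        ≈⟨ R.+-congʳ (R.sym (R.distribˡ _ _ _)) ⟩
      f 0 R.* (g ⊛ h) (suc n) R.+ (tail f ⊛ (g ⊛ h)) n ∎

    ⊛-suc : ∀ f g n → (f ⊛ g) (suc n) R.≈ f (suc n) R.* g 0 R.+ (f ⊛ tail g) n
    ⊛-suc f g zero    = R.+-comm _ _
    ⊛-suc f g (suc n) = R.trans (R.+-congˡ (⊛-suc (tail f) g n)) (RS.x∙yz≈y∙xz _ _ _)

    ⊛-comm : ∀ f g → f ⊛ g ≐ g ⊛ f
    ⊛-comm f g zero    = R.*-comm _ _
    ⊛-comm f g (suc n) = R.trans (R.+-cong (R.*-comm _ _) (⊛-comm (tail f) g n)) (R.sym (⊛-suc g f n))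

    ⊛-zeroˡ : ∀ f → (λ _ → R.0#) ⊛ f ≐ (λ _ → R.0#)
    ⊛-zeroˡ f zero    = R.zeroˡ _
    ⊛-zeroˡ f (suc n) = R.trans (R.+-cong (R.zeroˡ _) (⊛-zeroˡ f n)) (R.+-identityˡ _)

    ⊛-identityˡ : ∀ f → const R.1# ⊛ f ≐ f
    ⊛-identityˡ f zero    = R.*-identityˡ _
    ⊛-identityˡ f (suc n) = R.trans (R.+-cong (R.*-identityˡ _) (⊛-zeroˡ f n)) (R.+-identityʳ _)

  commutativeRing : CommutativeRing c ℓ
  commutativeRing = record
    { Carrier = Series
    ; _≈_ = _≐_
    ; _+_ = _⊕_
    ; _*_ = _⊛_
    ; -_  = λ f n → R.- f n
    ; 0#  = λ _ → R.0#
    ; 1#  = const R.1#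
    ; isCommutativeRing = record
      { isRing = record
        { +-isAbelianGroup = P.isAbelianGroup R.+-isAbelianGroup
        ; *-cong = ⊛-cong
        ; *-assoc = ⊛-assoc
        ; *-identity = ⊛-identityˡ , λ f n → R.trans (⊛-comm f (const R.1#) n) (⊛-identityˡ f n)
        ; distrib = (λ h f g n → R.trans (⊛-comm h (f ⊕ g) n) (R.trans (⊛-distribʳ h f g n)
                                   (R.+-cong (⊛-comm f h n) (⊛-comm g h n))))
                  , ⊛-distribʳ
        }
      ; *-comm = ⊛-comm
      }
    }

  open CommutativeRing commutativeRing public
    using (Carrier; _≈_; _+_; _*_; -_; _-_; 0#; 1#)
  open Exp (CommutativeRing.semiring commutativeRing) public using (_^_)

  private
    module S = CommutativeRing commutativeRing
    module SP = RingProperties S.ring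

  ⟨_⨾_⟩ : Carrier → Carrier → ℕ → Carrier
  ⟨ x ⨾ y ⟩ zero    = 1#
  ⟨ x ⨾ y ⟩ (suc N) = ⟨ x ⨾ y ⟩ N * (1# - x * y ^ N)

  -- The infinite product (x;y)_∞ = ∏_{i ≥ 0} (1 - x yⁱ), for y without
  -- constant term: the factors with i > n do not affect the coefficient
  -- of Xⁿ (⟨⨾⟩∞-limit below).
  ⟨_⨾_⟩∞ : Carrier → Carrier → Carrier
  ⟨ x ⨾ y ⟩∞ n = ⟨ x ⨾ y ⟩ (suc n) n

  geometric : Carrier → ℕ → Carrier
  geometric f zero    = 0#
  geometric f (suc N) = geometric f N + (1# - f) ^ N

  -- The inverse Σ_{j ≥ 0} (1 - f)ʲ of a series f with constant term 1
  -- (⁻¹-inverseʳ below).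
  infix 8 _⁻¹
  _⁻¹ : Carrier → Carrier
  (f ⁻¹) n = geometric f (suc n) n

  infixl 7 _/_
  _/_ : Carrier → Carrier → Carrier
  f / g = f * g ⁻¹

  private
    VanishesBelow : ℕ → Carrier → Set ℓ
    VanishesBelow N f = ∀ n → n ℕ.< N → f n R.≈ R.0#

    vanishes-*ˡ : ∀ {N g} f → VanishesBelow N g → VanishesBelow N (f * g)
    vanishes-*ˡ f v zero    n<N = R.trans (R.*-congˡ (v 0 n<N)) (R.zeroʳ _)
    vanishes-*ˡ f v (suc n) n<N = R.trans
      (R.+-cong (R.trans (R.*-congˡ (v (suc n) n<N)) (R.zeroʳ _)) (vanishes-*ˡ (tail f) v n (ℕ.<⇒≤ n<N)))
      (R.+-identityˡ _)

    vanishes-^ : ∀ f → f 0 R.≈ R.0# → ∀ N → VanishesBelow N (f ^ N)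
    vanishes-^ f f₀ (suc N) zero    _         = R.trans (R.*-congʳ f₀) (R.zeroˡ _)
    vanishes-^ f f₀ (suc N) (suc n) (s≤s n<N) = R.trans
      (R.+-cong (R.trans (R.*-congʳ f₀) (R.zeroˡ _)) (vanishes-*ˡ (tail f) (vanishes-^ f f₀ N) n n<N))
      (R.+-identityˡ _)

    eventually : (s : ℕ → Carrier) → (∀ N n → n ℕ.< N → s (suc N) n R.≈ s N n) →
                 ∀ n N → n ℕ.< N → s N n R.≈ s (suc n) n
    eventually s step n (suc N) (s≤s n≤N) with n ℕ.≟ N
    ... | yes refl = R.refl
    ... | no  n≢N  = R.trans (step N n n<N) (eventually s step n N n<N)
      where n<N = ℕ.≤∧≢⇒< n≤N n≢N

    -‿zero : ∀ {r} → r R.≈ R.0# → R.- r R.≈ R.0#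
    -‿zero r≈0 = R.trans (R.-‿cong r≈0) RP.-0#≈0#

    telescope : ∀ f N → f * geometric f N ≈ 1# - (1# - f) ^ N
    telescope f zero    = S.trans (S.zeroʳ f) (S.sym (S.-‿inverseʳ 1#))
    telescope f (suc N) = S.trans (S.distribˡ f (geometric f N) u) (S.trans (S.+-congʳ {f * u} (telescope f N))
      (S.trans (S.+-assoc 1# (- u) (f * u)) (S.+-congˡ {1#} (S.sym eq))))
      where
      u : Carrier
      u = (1# - f) ^ N
      eq : - ((1# - f) * u) ≈ - u + f * u
      eq = S.trans (S.-‿cong (S.trans (S.distribʳ u 1# (- f)) (S.+-cong (S.*-identityˡ u) (S.sym (SP.-‿distribˡ-* f u)))))
             (S.trans (S.sym (SP.-‿+-comm u (- (f * u)))) (S.+-congˡ { - u} (SP.-‿involutive (f * u))))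

  ⟨⨾⟩∞-limit : ∀ x y → y 0 R.≈ R.0# → ∀ n N → n ℕ.< N → ⟨ x ⨾ y ⟩ N n R.≈ ⟨ x ⨾ y ⟩∞ n
  ⟨⨾⟩∞-limit x y y₀ = eventually ⟨ x ⨾ y ⟩ step
    where
    step : ∀ N n → n ℕ.< N → ⟨ x ⨾ y ⟩ (suc N) n R.≈ ⟨ x ⨾ y ⟩ N n
    step N n n<N = begin
      (p * (1# - t)) n               ≈⟨ S.distribˡ p 1# (- t) n ⟩
      (p * 1#) n R.+ (p * (- t)) n   ≈⟨ R.+-cong (S.*-identityʳ p n) (vanishes-*ˡ p -t-vanishes n n<N) ⟩
      p n R.+ R.0#                   ≈⟨ R.+-identityʳ _ ⟩
      p n                            ∎
      where
      p t : Carrier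
      p = ⟨ x ⨾ y ⟩ N
      t = x * y ^ N
      -t-vanishes : VanishesBelow N (- t)
      -t-vanishes i i<N = -‿zero (vanishes-*ˡ x (vanishes-^ y y₀ N) i i<N)

  ⟨⨾⟩∞-constant : ∀ x y → x 0 R.≈ R.0# → ⟨ x ⨾ y ⟩∞ 0 R.≈ R.1#
  ⟨⨾⟩∞-constant x y x₀ = R.trans (R.*-identityˡ _)
    (R.trans (R.+-congˡ (-‿zero (R.trans (R.*-congʳ x₀) (R.zeroˡ _)))) (R.+-identityʳ _))

  ⁻¹-inverseʳ : ∀ f → f 0 R.≈ R.1# → f * f ⁻¹ ≈ 1#
  ⁻¹-inverseʳ f f₀ n = begin
    (f * f ⁻¹) n                       ≈⟨ ⊛-cong≤ n (λ _ → R.refl) (λ i i≤n → R.sym (eventually (geometric f) step i (suc n) (s≤s i≤n))) ⟩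
    (f * geometric f (suc n)) n        ≈⟨ telescope f (suc n) n ⟩
    1# n R.- ((1# - f) ^ suc n) n      ≈⟨ R.+-congˡ (-‿zero (vanishes-^ (1# - f) u₀ (suc n) n ℕ.≤-refl)) ⟩
    1# n R.+ R.0#                      ≈⟨ R.+-identityʳ _ ⟩
    1# n                               ∎
    where
    u₀ : (1# - f) 0 R.≈ R.0#
    u₀ = R.trans (R.+-congˡ (R.-‿cong f₀)) (R.-‿inverseʳ _)
    step : ∀ N n → n ℕ.< N → geometric f (suc N) n R.≈ geometric f N n
    step N n n<N = R.trans (R.+-congˡ (vanishes-^ (1# - f) u₀ N n n<N)) (R.+-identityʳ _)

-- The rings ℤ⟦q⟧ and ℤ⟦a,c,d⟧⟦q⟧.  An element of the latter is a
-- function of the exponents of q, a, c, d, in this order.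

module ℤ⟦q⟧ where
  open PowerSeries +-*-commutativeRing public renaming (X to q)

module ℤ⟦a,c,d⟧⟦q⟧ where
  private
    module D = PowerSeries +-*-commutativeRing
    module C = PowerSeries D.commutativeRing
    module A = PowerSeries C.commutativeRing
  open PowerSeries A.commutativeRing public renaming (X to q)

  a c d : Carrier
  a = const A.X
  c = const (A.const C.X)
  d = const (A.const (C.const D.X))

data Colour : Set where
  a b c d : Colour

infix 4 _≟ᶜ_
_≟ᶜ_ : DecidableEquality Colour
a ≟ᶜ a = yes refl
a ≟ᶜ b = no λ ()
a ≟ᶜ c = no λ ()
a ≟ᶜ d = no λ ()
b ≟ᶜ a = no λ ()
b ≟ᶜ b = yes refl
b ≟ᶜ c = no λ ()
b ≟ᶜ d = no λ ()
c ≟ᶜ a = no λ ()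
c ≟ᶜ b = no λ ()
c ≟ᶜ c = yes refl
c ≟ᶜ d = no λ ()
d ≟ᶜ a = no λ ()
d ≟ᶜ b = no λ ()
d ≟ᶜ c = no λ ()
d ≟ᶜ d = yes refl

B₂ : Colour → Colour → ℕ
B₂ a a = 4
B₂ a b = 1
B₂ a c = 3
B₂ a d = 2
B₂ b a = 3
B₂ b b = 0
B₂ b c = 2
B₂ b d = 1
B₂ c a = 1
B₂ c b = 2
B₂ c c = 0
B₂ c d = 3
B₂ d a = 2
B₂ d b = 3
B₂ d c = 1
B₂ d d = 4

infix 6 _▹_
record Part : Set where
  constructor _▹_
  field
    size   : ℕ
    colour : Colour
open Part public

infix 4 _≟ᵖ_
_≟ᵖ_ : DecidableEquality Part
(s ▹ x) ≟ᵖ (t ▹ y) = map′ (uncurry (cong₂ _▹_)) (λ p → cong size p , cong colour p) ((s ℕ.≟ t) ×-dec (x ≟ᶜ y))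

ParityAllowed : Colour → ℕ → Set
ParityAllowed a s = 2 ∤ s
ParityAllowed b s = 2 ∣ s
ParityAllowed c s = 2 ∣ s
ParityAllowed d s = 2 ∤ s

AllowedPart : Part → Set
AllowedPart p = 1 ℕ.≤ size p × ParityAllowed (colour p) (size p) × p ≢ 1 ▹ d

-- size p - size p′ ≥ B₂ (colour p) (colour p′), written without
-- subtraction, which is truncated on ℕ.
Gap : Part → Part → Set
Gap p p′ = B₂ (colour p) (colour p′) ℕ.+ size p′ ℕ.≤ size p

Admissible : List Part → Set
Admissible ps = All AllowedPart ps × Linked Gap ps

weight : List Part → ℕ
weight ps = sum (map size ps)

#[_] : Colour → List Part → ℕ
#[ x ] ps = length (filter (λ p → colour p ≟ᶜ x) ps)

AdmissibleOf : ℕ → List Part → Set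
AdmissibleOf n ps = Admissible ps × weight ps ≡ n

AdmissibleOfType : ℕ → ℕ → ℕ → ℕ → List Part → Set
AdmissibleOfType n k ℓ m ps = AdmissibleOf n ps × #[ a ] ps ≡ k × #[ c ] ps ≡ ℓ × #[ d ] ps ≡ m

-- The predicate P holds for exactly the entries of a repetition-free
-- list; the length of that list is the number of solutions of P.
record Enumeration {A : Set} (P : A → Set) : Set where
  field
    elements : List A
    unique   : Unique elements
    sound    : ∀ {x} → x ∈ elements → P x
    complete : ∀ {x} → P x → x ∈ elements

  size# : ℕ
  size# = length elements

open Enumeration public using (size#)

refine : {A : Set} {P Q : A → Set} → Decidable Q → (∀ {x} → Q x → P x) → Enumeration P → Enumeration Q
refine Q? Q⇒P E = record
  { elements = filter Q? (elements E)
  ; unique   = filter⁺ Q? (unique E)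
  ; sound    = λ x∈ → proj₂ (∈-filter⁻ Q? {xs = elements E} x∈)
  ; complete = λ Qx → ∈-filter⁺ Q? (complete E (Q⇒P Qx)) Qx
  }
  where open Enumeration

parityAllowed? : ∀ x s → Dec (ParityAllowed x s)
parityAllowed? a s = ¬? (2 ∣? s)
parityAllowed? b s = 2 ∣? s
parityAllowed? c s = 2 ∣? s
parityAllowed? d s = ¬? (2 ∣? s)

allowedPart? : Decidable AllowedPart
allowedPart? p = (1 ℕ.≤? size p) ×-dec parityAllowed? (colour p) (size p) ×-dec ¬? (p ≟ᵖ 1 ▹ d)

admissibleOf? : ∀ n → Decidable (AdmissibleOf n)
admissibleOf? n ps =
  (all? allowedPart? ps ×-dec linked? (λ p p′ → B₂ (colour p) (colour p′) ℕ.+ size p′ ℕ.≤? size p) ps)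
  ×-dec (weight ps ℕ.≟ n)

admissibleOfType? : ∀ n k ℓ m → Decidable (AdmissibleOfType n k ℓ m)
admissibleOfType? n k ℓ m ps =
  admissibleOf? n ps ×-dec (#[ a ] ps ℕ.≟ k) ×-dec (#[ c ] ps ℕ.≟ ℓ) ×-dec (#[ d ] ps ℕ.≟ m)

private
  colours : List Colour
  colours = a ∷ b ∷ c ∷ d ∷ []

  colours! : Unique colours
  colours! = ((λ ()) ∷ (λ ()) ∷ (λ ()) ∷ []) ∷ ((λ ()) ∷ (λ ()) ∷ []) ∷ ((λ ()) ∷ []) ∷ [] ∷ []

  ∈-colours : ∀ x → x ∈ colours
  ∈-colours a = here refl
  ∈-colours b = there (here refl)
  ∈-colours c = there (there (here refl))
  ∈-colours d = there (there (there (here refl)))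

  parts≤ : ℕ → List Part
  parts≤ n = cartesianProductWith _▹_ (upTo (suc n)) colours

  lists : List Part → ℕ → List (List Part)
  lists ps zero    = [] ∷ []
  lists ps (suc j) = [] ∷ cartesianProductWith _∷_ ps (lists ps j)

  lists! : ∀ {ps} → Unique ps → ∀ j → Unique (lists ps j)
  lists! ps! zero = [] ∷ []
  lists! {ps} ps! (suc j) =
    All.tabulate (λ { v∈ refl → case-[] (∈-cartesianProductWith⁻ _∷_ ps (lists ps j) v∈) })
    ∷ cartesianProductWith⁺ _∷_ ∷-injective ps! (lists! ps! j)
    where
    open import Data.Empty using (⊥)
    open import Data.Product.Base using (∃₂)
    case-[] : (∃₂ λ x xs → x ∈ ps × xs ∈ lists ps j × [] ≡ x ∷ xs) → ⊥
    case-[] (_ , _ , _ , _ , ())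

  ∈-lists : ∀ {n} ps j → weight ps ℕ.≤ n → weight ps ℕ.≤ j → All AllowedPart ps → ps ∈ lists (parts≤ n) j
  ∈-lists []       zero    _ _ _ = here refl
  ∈-lists []       (suc j) _ _ _ = here refl
  ∈-lists ((zero ▹ x) ∷ ps) j _ _ ((() , _) ∷ _)
  ∈-lists ((suc s ▹ x) ∷ ps) (suc j) w≤n (s≤s w≤j) (_ ∷ qs) = there
    (∈-cartesianProductWith⁺ _∷_
      (∈-cartesianProductWith⁺ _▹_ (∈-upTo⁺ (s≤s (ℕ.≤-trans (ℕ.m≤m+n (suc s) _) w≤n))) (∈-colours x))
      (∈-lists ps j (ℕ.≤-trans (ℕ.m≤n+m _ (suc s)) w≤n) (ℕ.≤-trans (ℕ.m≤n+m _ s) w≤j) qs))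

  parts≤! : ∀ n → Unique (parts≤ n)
  parts≤! n = cartesianProductWith⁺ _▹_ (λ eq → cong size eq , cong colour eq) (upTo⁺ (suc n)) colours!

admissibleOf : ∀ n → Enumeration (AdmissibleOf n)
admissibleOf n = record
  { elements = filter (admissibleOf? n) (lists (parts≤ n) n)
  ; unique   = filter⁺ (admissibleOf? n) (lists! (parts≤! n) n)
  ; sound    = λ x∈ → proj₂ (∈-filter⁻ (admissibleOf? n) {xs = lists (parts≤ n) n} x∈)
  ; complete = λ { {ps} P@((allowed , _) , w) →
      ∈-filter⁺ (admissibleOf? n) (∈-lists ps n (ℕ.≤-reflexive w) (ℕ.≤-reflexive w) allowed) P }
  }

admissibleOfType : ∀ n k ℓ m → Enumeration (AdmissibleOfType n k ℓ m)
admissibleOfType n k ℓ m = refine (admissibleOfType? n k ℓ m) proj₁ (admissibleOf n)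

A₂ : ℕ → ℕ → ℕ → ℕ → ℕ
A₂ n k ℓ m = size# (admissibleOfType n k ℓ m)

A₂-total : ℕ → ℕ
A₂-total n = size# (admissibleOf n)

{-# OPTIONS --safe #-}

-- Put p = q², α = aq, γ = cq², δ = dq³, and let F_k, J_k be the
-- generating functions of the sequences that may follow a part 2k + 1
-- of colour a, respectively a part 2k + 2 of colour c.  Removing the
-- first part gives
--   (1 - p^{k+2}) F_{k+2} = F_{k+1} + α p^k F_k + (γ + δ) p^k J_k,
--   (1 - γ p^{k+1}) J_{k+1} = (1 + α p^{k+1}) F_{k+1} + α p^k F_k + γ p^k J_k.
-- Over the series in a new variable z this system is solved by
--   Σ F_k z^k = ε(z) V(z²),   Σ J_k z^k = ε(z) T(z²),
-- where ε(z) = (-z;p)_∞ and V is the basic hypergeometric series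
--   V(w) = Σ u_k w^k,   u_k = (-α;p²)_k (-δ;p²)_k / ((p²;p²)_k (γ;p²)_k),
-- because the functional equation ε(z) = (1 + z) ε(pz) reduces it to the
-- two-term recurrence of u.  For α = γ = δ = 0 the solution is
-- F_N = 1 / (p;p)_N.  For large N only terms with large k matter in
-- F_N = Σ_{j+2k=N} ε_j u_k, and there u_k (γ;p²)_∞ agrees with
-- (-α;p²)_∞ (-δ;p²)_∞ / (p²;p²)_k; hence F_N tends to the stated product.

module Submission where

open import Algebra.Bundles using (CommutativeRing)
import Algebra.Properties.Ring as RingProperties
import Algebra.Properties.Semiring.Exp as Exp
import Algebra.Solver.Ring.NaturalCoefficients.Default as Solver
open import Data.Empty using (⊥; ⊥-elim)
open import Data.Integer.Base as ℤ using (ℤ; +_)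
import Data.Integer.Properties as ℤ
open import Data.List.Base using (List; []; _∷_; _++_; map; length; filter)
import Data.List.Membership.DecPropositional as DecMembership
open import Data.List.Membership.Propositional using (_∈_; _∉_)
open import Data.List.Membership.Propositional.Properties using (∈-map⁺; ∈-map⁻; ∈-++⁺ˡ; ∈-++⁺ʳ; ∈-++⁻)
open import Data.List.Membership.Propositional.Properties.WithK using (unique∧set⇒bag)
open import Data.List.Properties using (∷-injectiveʳ; filter-accept; filter-reject)
open import Data.List.Relation.Binary.BagAndSetEquality using (∼bag⇒↭)
open import Data.List.Relation.Binary.Permutation.Propositional as ↭ using (_↭_)
open import Data.List.Relation.Unary.All as All using (All; []; _∷_)
open import Data.List.Relation.Unary.AllPairs using ([]; _∷_)
open import Data.List.Relation.Unary.Any using (here; there)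
open import Data.List.Relation.Unary.Linked using (Linked; []; [-]; _∷_)
open import Data.List.Relation.Unary.Unique.Propositional using (Unique)
open import Data.List.Relation.Unary.Unique.Propositional.Properties using (++⁺; map⁺)
open import Data.Nat.Base as ℕ using (ℕ; zero; suc; z≤n; s≤s; ⌊_/2⌋)
open import Data.Nat.Divisibility using (_∣_; _∤_; divides)
import Data.Nat.Properties as ℕ
open import Data.Product.Base using (_×_; _,_; proj₁; proj₂; ∃)
open import Data.Sum.Base using (_⊎_; inj₁; inj₂)
open import Data.Unit.Base using (⊤; tt)
open import Function.Base using (_∘_; id)
open import Function.Bundles using (mk⇔)
open import Level using (Level)
open import Relation.Binary.PropositionalEquality as ≡ using (_≡_; _≢_)
import Relation.Binary.Reasoning.Setoid as SetoidReasoning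
open import Relation.Nullary using (¬_; Dec; yes; no; _×-dec_)
open import Relation.Unary using (Decidable)
open import Defs using (A₂; A₂-total; module ℤ⟦a,c,d⟧⟦q⟧; module ℤ⟦q⟧)
open import Defs using (module PowerSeries; Colour; module Colour; Part; _▹_; size; colour; _≟ᵖ_; B₂; Gap; AllowedPart; weight; #[_])
open import Defs using (AdmissibleOf; AdmissibleOfType; admissibleOf?; admissibleOfType?; Enumeration; module Enumeration; refine; admissibleOf)

open Enumeration using (elements; unique; sound; complete)

-- Shifts, dilation and spreading of power series.

module SeriesProperties {r ℓ : Level} (R : CommutativeRing r ℓ) where
  private
    module R = CommutativeRing R
  open PowerSeries R
  open CommutativeRing commutativeRing using (*-identityˡ; zeroˡ)

  X*-zero : ∀ f → (X * f) 0 R.≈ R.0#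
  X*-zero f = R.zeroˡ _

  X*-suc : ∀ f n → (X * f) (suc n) R.≈ f n
  X*-suc f n = R.trans (R.+-cong (R.zeroˡ _) (*-identityˡ f n)) (R.+-identityˡ _)

  const* : ∀ r f n → (const r * f) n R.≈ r R.* f n
  const* r f zero    = R.refl
  const* r f (suc n) = R.trans (R.+-congˡ (zeroˡ f n)) (R.+-identityʳ _)

module Dilation {r ℓ : Level} (R : CommutativeRing r ℓ) (p : CommutativeRing.Carrier R) where
  private
    module R = CommutativeRing R
    module E = Exp R.semiring
  open PowerSeries R
  private
    module S = CommutativeRing commutativeRing
  open Solver R.commutativeSemiring

  -- f(z) ↦ f(pz)
  dilate : Carrier → Carrier
  dilate f n = p E.^ n R.* f n

  private
    -- The tail of `dilate f` is `p` times the dilation of the tail of `f`; the scalar `s` collects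
    -- these factors along the Cauchy product.
    dilate-*′ : ∀ s f g n → ((λ i → s R.* dilate f i) * dilate g) n R.≈ s R.* dilate (f * g) n
    dilate-*′ s f g zero = solve 3 (λ s f g → (s :* (con 1 :* f)) :* (con 1 :* g) := s :* (con 1 :* (f :* g))) R.refl s (f 0) (g 0)
    dilate-*′ s f g (suc n) = R.trans
      (R.+-congˡ (R.trans (S.*-cong {y = λ i → (s R.* p) R.* dilate (f ∘ suc) i}
          (λ i → solve 4 (λ s p y f → s :* (p :* y :* f) := s :* p :* (y :* f)) R.refl s p (p E.^ i) (f (suc i)))
          (S.refl {dilate g}) n)
        (dilate-*′ (s R.* p) (f ∘ suc) g n)))
      (solve 6 (λ s p y f g h → s :* (con 1 :* f) :* (p :* y :* g) :+ s :* p :* (y :* h)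
                             := s :* (p :* y :* (f :* g :+ h)))
        R.refl s p (p E.^ n) (f 0) (g (suc n)) (((f ∘ suc) * g) n))

  dilate-* : ∀ f g → dilate f * dilate g ≈ dilate (f * g)
  dilate-* f g n = R.trans (S.*-cong (λ i → R.sym (R.*-identityˡ (dilate f i))) (S.refl {dilate g}) n)
    (R.trans (dilate-*′ R.1# f g n) (R.*-identityˡ _))

-- f(z) ↦ f(z²)
spread : ∀ {ℓ} {A : Set ℓ} → A → (ℕ → A) → ℕ → A
spread o f zero          = f 0
spread o f (suc zero)    = o
spread o f (suc (suc n)) = spread o (f ∘ suc) n

-- Functional equations in z and the recurrences read off from them.

module _ {r ℓ : Level} (S : CommutativeRing r ℓ) where
  open CommutativeRing S
  open SetoidReasoning setoid
  open Solver commutativeSemiring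

  -- Primed letters stand for the series dilated by z -> pz. In an abstract ring the derivations
  -- become polynomial identities for the solver.
  module Functional
    {z γ α δ ε ε′ V V′ T T′ F F′ J J′ : Carrier}
    (F-eq : F ≈ ε * V) (J-eq : J ≈ ε * T)
    (ε-eq : ε ≈ ε′ + z * ε′) (T-eq : T ≈ γ * T′ + (V + α * V′)) (V-eq : V ≈ V′ + z * (z * (T + δ * T′)))
    (F′-eq : F′ ≈ ε′ * V′) (J′-eq : J′ ≈ ε′ * T′) where
    -- Multiplying `T-eq` by `ε` produces ε V, which is `F`; only the remaining, already dilated
    -- terms are rewritten by ε = (1 + z) ε′.
    J-functional : J ≈ (F + α * F′) + (γ * J′ + z * (α * F′ + γ * J′))
    J-functional = begin
      J ≈⟨ trans J-eq (*-congˡ T-eq) ⟩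
      ε * (γ * T′ + (V + α * V′))
        ≈⟨ solve 6 (λ ε γ T′ V α V′ → ε :* (γ :* T′ :+ (V :+ α :* V′)) := ε :* V :+ ε :* (γ :* T′ :+ α :* V′)) refl ε γ T′ V α V′ ⟩
      ε * V + ε * (γ * T′ + α * V′) ≈⟨ +-cong (sym F-eq) (*-congʳ ε-eq) ⟩
      F + (ε′ + z * ε′) * (γ * T′ + α * V′)
        ≈⟨ solve 7 (λ F ε′ z γ T′ α V′ → F :+ (ε′ :+ z :* ε′) :* (γ :* T′ :+ α :* V′)
             := (F :+ α :* (ε′ :* V′)) :+ (γ :* (ε′ :* T′) :+ z :* (α :* (ε′ :* V′) :+ γ :* (ε′ :* T′)))) refl F ε′ z γ T′ α V′ ⟩
      (F + α * (ε′ * V′)) + (γ * (ε′ * T′) + z * (α * (ε′ * V′) + γ * (ε′ * T′)))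
        ≈⟨ +-cong (+-congˡ (*-congˡ (sym F′-eq))) (+-cong (*-congˡ (sym J′-eq)) (*-congˡ (+-cong (*-congˡ (sym F′-eq)) (*-congˡ (sym J′-eq))))) ⟩
      (F + α * F′) + (γ * J′ + z * (α * F′ + γ * J′)) ∎

    -- Here ε = (1 + z) ε′ comes first, and `V` is expanded by `V-eq` only in ε′ V. The term z² ε′ V
    -- arising through `T-eq` joins z ε′ V to form z F.
    F-functional : F ≈ F′ + z * (F + z * (α * F′ + (γ * J′ + δ * J′)))
    F-functional = begin
      F ≈⟨ trans F-eq (*-congʳ ε-eq) ⟩
      (ε′ + z * ε′) * V
        ≈⟨ solve 3 (λ ε′ z V → (ε′ :+ z :* ε′) :* V := ε′ :* V :+ z :* (ε′ :* V)) refl ε′ z V ⟩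
      ε′ * V + z * (ε′ * V) ≈⟨ +-congʳ (*-congˡ (trans V-eq (+-congˡ (*-congˡ (*-congˡ (+-congʳ T-eq)))))) ⟩
      ε′ * (V′ + z * (z * ((γ * T′ + (V + α * V′)) + δ * T′))) + z * (ε′ * V)
        ≈⟨ solve 8 (λ ε′ V′ z γ T′ V α δ → ε′ :* (V′ :+ z :* (z :* ((γ :* T′ :+ (V :+ α :* V′)) :+ δ :* T′))) :+ z :* (ε′ :* V)
             := ε′ :* V′ :+ z :* ((ε′ :+ z :* ε′) :* V :+ z :* (α :* (ε′ :* V′) :+ (γ :* (ε′ :* T′) :+ δ :* (ε′ :* T′))))) refl ε′ V′ z γ T′ V α δ ⟩
      ε′ * V′ + z * ((ε′ + z * ε′) * V + z * (α * (ε′ * V′) + (γ * (ε′ * T′) + δ * (ε′ * T′))))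
        ≈⟨ +-cong (sym F′-eq) (*-congˡ (+-cong (sym (trans F-eq (*-congʳ ε-eq)))
             (*-congˡ (+-cong (*-congˡ (sym F′-eq)) (+-cong (*-congˡ (sym J′-eq)) (*-congˡ (sym J′-eq))))))) ⟩
      F′ + z * (F + z * (α * F′ + (γ * J′ + δ * J′))) ∎

module _ {r ℓ : Level} (R : CommutativeRing r ℓ) where
  open CommutativeRing R
  open Exp semiring using (_^_)

  -- Each recurrence is written y = x y + s, the subtraction-free form of (1 - x) y = s. The
  -- sequence `t` splits the ratio of consecutive `u` into (1 + αP^k)/(1 - γP^k) and (1 + δP^k)/(1 -
  -- P^(k+1)).
  module ClosedForm
    (p P α γ δ : Carrier) (p*p≈P : p * p ≈ P)
    (ε u t : ℕ → Carrier) (u₀ : u 0 ≈ 1#)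
    (ε-suc : ∀ j → ε (suc j) ≈ p ^ suc j * ε (suc j) + p ^ j * ε j)
    (t-def : ∀ k → t k ≈ γ * P ^ k * t k + (u k + α * P ^ k * u k))
    (u-suc : ∀ k → u (suc k) ≈ P ^ suc k * u (suc k) + (t k + δ * P ^ k * t k))
    where

    private
      module Z = PowerSeries R
      module Z′ = CommutativeRing Z.commutativeRing
      open SeriesProperties R
      open Dilation R p
      open Z using (const) renaming (X to z; _+_ to _⊕_; _*_ to _⊛_; _≈_ to _≐_)
      open Solver commutativeSemiring

      ⟪_⟫ : (ℕ → Carrier) → Z.Carrier
      ⟪ f ⟫ = spread 0# f

    F J : ℕ → Carrier
    F = ε ⊛ ⟪ u ⟫
    J = ε ⊛ ⟪ t ⟫

    private
      scale : (ℕ → Carrier) → ℕ → Carrier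
      scale f k = P ^ k * f k

      -- One index of `f` takes up two places, so `p` is met twice and becomes `P`; the scalar `s`
      -- collects these powers.
      dilate-spread′ : ∀ s f n → s * (p ^ n * ⟪ f ⟫ n) ≈ ⟪ (λ k → s * scale f k) ⟫ n
      dilate-spread′ s f zero = refl
      dilate-spread′ s f (suc zero) = trans (*-congˡ (zeroʳ _)) (zeroʳ s)
      dilate-spread′ s f (suc (suc n)) = trans
        (trans (solve 4 (λ s p y f → s :* (p :* (p :* y) :* f)
                   := s :* (p :* p) :* (y :* f)) refl s p (p ^ n) (⟪ f ∘ suc ⟫ n))
          (*-congʳ (*-congˡ p*p≈P)))
        (trans (dilate-spread′ (s * P) (f ∘ suc) n)
          (spread-cong (λ k → solve 4 (λ s p y f → s :* p :* (y :* f)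
              := s :* (p :* y :* f)) refl s P (P ^ k) (f (suc k))) n))
        where
        spread-cong : ∀ {f g} → (∀ k → f k ≈ g k) → ∀ n → ⟪ f ⟫ n ≈ ⟪ g ⟫ n
        spread-cong f≈g zero = f≈g 0
        spread-cong f≈g (suc zero) = refl
        spread-cong f≈g (suc (suc n)) = spread-cong (f≈g ∘ suc) n

      dilate-spread : ∀ f → dilate ⟪ f ⟫ ≐ ⟪ scale f ⟫
      dilate-spread f n = trans (sym (*-identityˡ _)) (trans (dilate-spread′ 1# f n) (spread-1* n))
        where
        spread-1* : ∀ {f} n → ⟪ (λ k → 1# * f k) ⟫ n ≈ ⟪ f ⟫ n
        spread-1* zero = *-identityˡ _
        spread-1* (suc zero) = refl
        spread-1* (suc (suc n)) = spread-1* n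

      -- In the uses below `Q` is linear and homogeneous, so it also holds between the zeros at odd
      -- places.
      spread-relation : ∀ {ℓ′} (Q : Carrier → Carrier → Carrier → Carrier → Set ℓ′) {f g h i} →
        (∀ k → Q (f k) (g k) (h k) (i k)) → Q 0# 0# 0# 0# →
        ∀ n → Q (⟪ f ⟫ n) (⟪ g ⟫ n) (⟪ h ⟫ n) (⟪ i ⟫ n)
      spread-relation Q q o zero = q 0
      spread-relation Q q o (suc zero) = o
      spread-relation Q q o (suc (suc n)) = spread-relation Q (q ∘ suc) o n

      ε′ V T V′ T′ F′ J′ : Z.Carrier
      ε′ = dilate ε
      V  = ⟪ u ⟫
      T  = ⟪ t ⟫
      V′ = dilate V
      T′ = dilate T
      F′ = dilate F
      J′ = dilate J

      ε-eq : ε ≐ ε′ ⊕ z ⊛ ε′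
      ε-eq zero = sym (trans (+-cong (*-identityˡ _) (X*-zero ε′)) (+-identityʳ _))
      ε-eq (suc j) = trans (ε-suc j) (+-congˡ (sym (X*-suc ε′ j)))

      T-eq : T ≐ const γ ⊛ T′ ⊕ (V ⊕ const α ⊛ V′)
      T-eq n = trans
        (spread-relation (λ t t′ u u′ → t ≈ γ * t′ + (u + α * u′))
          (λ k → trans (t-def k) (+-cong (*-assoc _ _ _) (+-congˡ (*-assoc _ _ _))))
          (solve 2 (λ γ α → con 0 :=
              γ :* con 0 :+ (con 0 :+ α :* con 0)) refl γ α) n)
        (sym (+-cong (trans (const* γ T′ n) (*-congˡ (dilate-spread t n)))
               (+-congˡ (trans (const* α V′ n) (*-congˡ (dilate-spread u n))))))

      V-eq : V ≐ V′ ⊕ z ⊛ (z ⊛ (T ⊕ const δ ⊛ T′))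
      V-eq zero = sym (trans (+-cong (*-identityˡ _) (X*-zero (z ⊛ (T ⊕ const δ ⊛ T′)))) (+-identityʳ _))
      V-eq (suc zero) = sym (trans (+-cong (zeroʳ _)
        (trans (X*-suc (z ⊛ (T ⊕ const δ ⊛ T′)) 0) (X*-zero (T ⊕ const δ ⊛ T′)))) (+-identityʳ _))
      -- By computation `⟪ u ⟫` at `suc (suc n)` is the spread of the shifted sequence at `n`; this
      -- matches the factor z², and `u-suc` applies place by place.
      V-eq (suc (suc n)) = trans
        (spread-relation (λ u u′ t t′ → u ≈ u′ + (t + δ * t′))
          (λ k → trans (u-suc k) (+-congˡ (+-congˡ (*-assoc _ _ _))))
          (solve 1 (λ δ → con 0 :=
              con 0 :+ (con 0 :+ δ :* con 0)) refl δ) n)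
        (+-cong (sym (dilate-spread u (suc (suc n))))
          (sym (trans (X*-suc _ (suc n)) (trans (X*-suc _ n)
            (+-congˡ (trans (const* δ T′ n) (*-congˡ (dilate-spread t n))))))))

      F′-eq : F′ ≐ ε′ ⊛ V′
      F′-eq = Z′.sym {ε′ ⊛ V′} {F′} (dilate-* ε V)

      J′-eq : J′ ≐ ε′ ⊛ T′
      J′-eq = Z′.sym {ε′ ⊛ T′} {J′} (dilate-* ε T)

    private
      module Fn = Functional Z.commutativeRing {z} {const γ} {const α} {const δ} {ε} {ε′} {V} {V′} {T} {T′} {F} {F′} {J} {J′}
        (λ _ → refl) (λ _ → refl) ε-eq T-eq V-eq F′-eq J′-eq

      F-rest : Z.Carrier
      F-rest = const α ⊛ F′ ⊕ (const γ ⊛ J′ ⊕ const δ ⊛ J′)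

    F-zero : F 0 ≈ ε 0
    F-zero = trans (*-congˡ u₀) (*-identityʳ _)

    F-one : F 1 ≈ p * F 1 + F 0
    F-one = trans (Fn.F-functional 1) (+-cong (*-congʳ (*-identityʳ p))
      (trans (X*-suc (F ⊕ z ⊛ F-rest) 0) (trans (+-congˡ (X*-zero F-rest)) (+-identityʳ _))))

    F-suc-suc : ∀ k → F (suc (suc k)) ≈
      p ^ suc (suc k) * F (suc (suc k)) + (F (suc k) + (α * (p ^ k * F k) + (γ * (p ^ k * J k) + δ * (p ^ k * J k))))
    F-suc-suc k = trans (Fn.F-functional (suc (suc k))) (+-congˡ (trans (X*-suc _ (suc k))
      (+-congˡ (trans (X*-suc _ k) (+-cong (const* α F′ k) (+-cong (const* γ J′ k) (const* δ J′ k)))))))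

    J-zero : J 0 ≈ (F 0 + α * F 0) + γ * J 0
    J-zero = trans (Fn.J-functional 0)
      (+-cong (+-congˡ (trans (const* α F′ 0) (*-congˡ (*-identityˡ _))))
        (trans (+-cong (trans (const* γ J′ 0) (*-congˡ (*-identityˡ _))) (X*-zero (const α ⊛ F′ ⊕ const γ ⊛ J′))) (+-identityʳ _)))

    J-suc : ∀ k → J (suc k) ≈ (F (suc k) + α * (p ^ suc k * F (suc k))) +
      (γ * (p ^ suc k * J (suc k)) + (α * (p ^ k * F k) + γ * (p ^ k * J k)))
    J-suc k = trans (Fn.J-functional (suc k))
      (+-cong (+-congˡ (const* α F′ (suc k)))
        (+-cong (const* γ J′ (suc k)) (trans (X*-suc _ k) (+-cong (const* α F′ k) (const* γ J′ k)))))

-- Congruence modulo powers of X, and linear fixed-point equations.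

module Congruence {r ℓ : Level} (R : CommutativeRing r ℓ) where
  private
    module R = CommutativeRing R
  open PowerSeries R
  private
    module S = CommutativeRing commutativeRing
  open SeriesProperties R

  infix 4 _≡_[q^_]
  _≡_[q^_] : Carrier → Carrier → ℕ → Set ℓ
  f ≡ g [q^ N ] = ∀ n → n ℕ.< N → f n R.≈ g n

  ≈⇒≡ : ∀ {f g N} → f ≈ g → f ≡ g [q^ N ]
  ≈⇒≡ f≈g n _ = f≈g n

  ≡-trans : ∀ {f g h N} → f ≡ g [q^ N ] → g ≡ h [q^ N ] → f ≡ h [q^ N ]
  ≡-trans p q n n<N = R.trans (p n n<N) (q n n<N)

  ≡-weaken : ∀ {f g M N} → M ℕ.≤ N → f ≡ g [q^ N ] → f ≡ g [q^ M ]
  ≡-weaken M≤N p n n<M = p n (ℕ.≤-trans n<M M≤N)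

  *-congˡ-≡ : ∀ f {g h N} → g ≡ h [q^ N ] → f * g ≡ f * h [q^ N ]
  *-congˡ-≡ f p zero    n<N = R.*-congˡ (p 0 n<N)
  *-congˡ-≡ f p (suc n) n<N = R.+-cong (R.*-congˡ (p (suc n) n<N)) (*-congˡ-≡ (f ∘ suc) p n (ℕ.<⇒≤ n<N))

  *-congʳ-≡ : ∀ f {g h N} → g ≡ h [q^ N ] → g * f ≡ h * f [q^ N ]
  *-congʳ-≡ f {g} {h} p n n<N = R.trans (S.*-comm g f n) (R.trans (*-congˡ-≡ f p n n<N) (S.*-comm f h n))

  *-cong-≡ : ∀ {f f′ g g′ N} → f ≡ f′ [q^ N ] → g ≡ g′ [q^ N ] → f * g ≡ f′ * g′ [q^ N ]
  *-cong-≡ {f} {f′} {g} {g′} p p′ = ≡-trans {f * g} {f′ * g} {f′ * g′} (*-congʳ-≡ g p) (*-congˡ-≡ f′ p′)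

  X*-cong-≡ : ∀ {f g N} → f ≡ g [q^ N ] → X * f ≡ X * g [q^ suc N ]
  X*-cong-≡ {f} {g} p zero    _         = R.trans (X*-zero f) (R.sym (X*-zero g))
  X*-cong-≡ {f} {g} p (suc n) (s≤s n<N) = R.trans (X*-suc f n) (R.trans (p n n<N) (R.sym (X*-suc g n)))

  0*-constant : ∀ {f} g → f 0 R.≈ R.0# → (f * g) 0 R.≈ R.0#
  0*-constant g f₀ = R.trans (R.*-congʳ f₀) (R.zeroˡ _)

module Fixpoint {r ℓ : Level} (R : CommutativeRing r ℓ) where
  private
    module R = CommutativeRing R
    module RP = RingProperties R.ring
  open PowerSeries R
  private
    module S = CommutativeRing commutativeRing
    module SP = RingProperties S.ring
  open SetoidReasoning S.setoid

  1-constant : ∀ x → x 0 R.≈ R.0# → (1# - x) 0 R.≈ R.1#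
  1-constant x x₀ = R.trans (R.+-congˡ (R.trans (R.-‿cong x₀) RP.-0#≈0#)) (R.+-identityʳ _)

  -- The only y with y = x y + s when `x` has no constant term.
  solution : Carrier → Carrier → Carrier
  solution x s = s * (1# - x) ⁻¹

  1-x-expand : ∀ x y → y * (1# - x) ≈ y - x * y
  1-x-expand x y = begin
    y * (1# - x)     ≈⟨ S.distribˡ y 1# (- x) ⟩
    y * 1# + y * - x ≈⟨ S.+-cong (S.*-identityʳ y) (S.trans (S.sym (SP.-‿distribʳ-* y x)) (S.-‿cong (S.*-comm y x))) ⟩
    y - x * y        ∎

  fixed⇒ : ∀ {x y s} → y ≈ x * y + s → y * (1# - x) ≈ s
  fixed⇒ {x} {y} {s} eq = begin
    y * (1# - x)        ≈⟨ 1-x-expand x y ⟩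
    y - x * y           ≈⟨ S.+-congʳ eq ⟩
    (x * y + s) - x * y ≈⟨ S.+-congʳ (S.+-comm (x * y) s) ⟩
    (s + x * y) - x * y ≈⟨ S.+-assoc s (x * y) (- (x * y)) ⟩
    s + (x * y - x * y) ≈⟨ S.+-congˡ (S.-‿inverseʳ (x * y)) ⟩
    s + 0#              ≈⟨ S.+-identityʳ s ⟩
    s                   ∎

  ⇒fixed : ∀ {x y s} → y * (1# - x) ≈ s → y ≈ x * y + s
  ⇒fixed {x} {y} {s} eq = begin
    y                   ≈⟨ S.sym (S.+-identityˡ y) ⟩
    0# + y              ≈⟨ S.+-congʳ (S.sym (S.-‿inverseʳ (x * y))) ⟩
    (x * y - x * y) + y ≈⟨ S.+-assoc (x * y) (- (x * y)) y ⟩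
    x * y + (- (x * y) + y) ≈⟨ S.+-congˡ (S.+-comm (- (x * y)) y) ⟩
    x * y + (y - x * y) ≈⟨ S.+-congˡ (S.trans (S.sym (1-x-expand x y)) eq) ⟩
    x * y + s           ∎

  *-cancel : ∀ {f g h} → f 0 R.≈ R.1# → g * f ≈ h → g ≈ h * f ⁻¹
  *-cancel {f} {g} {h} f₀ eq = begin
    g             ≈⟨ S.sym (S.*-identityʳ g) ⟩
    g * 1#        ≈⟨ S.*-congˡ {g} (S.sym (⁻¹-inverseʳ f f₀)) ⟩
    g * (f * f ⁻¹) ≈⟨ S.sym (S.*-assoc g f (f ⁻¹)) ⟩
    g * f * f ⁻¹  ≈⟨ S.*-congʳ {f ⁻¹} eq ⟩
    h * f ⁻¹      ∎

  solution-* : ∀ {x} s → x 0 R.≈ R.0# → solution x s * (1# - x) ≈ s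
  solution-* {x} s x₀ = begin
    s * (1# - x) ⁻¹ * (1# - x)   ≈⟨ S.*-assoc s ((1# - x) ⁻¹) (1# - x) ⟩
    s * ((1# - x) ⁻¹ * (1# - x)) ≈⟨ S.*-congˡ {s} (S.trans (S.*-comm ((1# - x) ⁻¹) (1# - x)) (⁻¹-inverseʳ (1# - x) (1-constant x x₀))) ⟩
    s * 1#                       ≈⟨ S.*-identityʳ s ⟩
    s                            ∎

  fixed-unique : ∀ {x y y′ s s′} → x 0 R.≈ R.0# → y ≈ x * y + s → y′ ≈ x * y′ + s′ → s ≈ s′ → y ≈ y′
  fixed-unique {x} {y} {y′} {s} {s′} x₀ eq eq′ s≈s′ = begin
    y              ≈⟨ *-cancel {1# - x} {y} {s} (1-constant x x₀) (fixed⇒ {x} {y} {s} eq) ⟩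
    solution x s   ≈⟨ S.*-congʳ {(1# - x) ⁻¹} s≈s′ ⟩
    solution x s′  ≈⟨ S.sym (*-cancel {1# - x} {y′} {s′} (1-constant x x₀) (fixed⇒ {x} {y′} {s′} eq′)) ⟩
    y′             ∎

-- Product formulas and the limit of F_N.

module FactorStep {r ℓ : Level} (R : CommutativeRing r ℓ) where
  open CommutativeRing R
  open RingProperties ring using (-‿distribˡ-*; -‿involutive)
  open SetoidReasoning setoid
  open Solver commutativeSemiring

  1--x : ∀ x y → 1# - (- x) * y ≈ 1# + x * y
  1--x x y = +-congˡ (trans (-‿cong (sym (-‿distribˡ-* x y))) (-‿involutive _))

  -- The inductive step of `u-product`, with `y` = 1 + αP^k, `z` = δP^k and `i` the inverse of 1 -
  -- P^(k+1). The half-way value `t` is eliminated through t g′ = u y.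
  factor-step : ∀ {u t u′ g g′ b a d y z i} →
    u * g ≈ b * (a * d) → t * g′ ≈ u * y → u′ ≈ (t + z * t) * i →
    u′ * (g * g′) ≈ b * i * (a * y * (d * (1# + z)))
  factor-step {u} {t} {u′} {g} {g′} {b} {a} {d} {y} {z} {i} ih t-eq u′-eq = begin
    u′ * (g * g′) ≈⟨ *-congʳ u′-eq ⟩
    (t + z * t) * i * (g * g′)
      ≈⟨ solve 5 (λ t z i g g′ → (t :+ z :* t) :* i :* (g :* g′) := t :* g′ :* (g :* i :* (con 1 :+ z))) refl t z i g g′ ⟩
    t * g′ * (g * i * (1# + z)) ≈⟨ *-congʳ t-eq ⟩
    u * y * (g * i * (1# + z))
      ≈⟨ solve 5 (λ u y g i z → u :* y :* (g :* i :* (con 1 :+ z)) := u :* g :* (y :* i :* (con 1 :+ z))) refl u y g i z ⟩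
    u * g * (y * i * (1# + z)) ≈⟨ *-congʳ ih ⟩
    b * (a * d) * (y * i * (1# + z))
      ≈⟨ solve 6 (λ b a d y i z → b :* (a :* d) :* (y :* i :* (con 1 :+ z)) := b :* i :* (a :* y :* (d :* (con 1 :+ z)))) refl b a d y i z ⟩
    b * i * (a * y * (d * (1# + z))) ∎

⌊/2⌋-suc : ∀ n → ⌊ suc n /2⌋ ℕ.≤ suc ⌊ n /2⌋
⌊/2⌋-suc zero          = z≤n
⌊/2⌋-suc (suc zero)    = s≤s z≤n
⌊/2⌋-suc (suc (suc n)) = s≤s (⌊/2⌋-suc n)

⌊/2⌋-+ : ∀ i j → ⌊ i ℕ.+ j /2⌋ ℕ.≤ i ℕ.+ ⌊ j /2⌋
⌊/2⌋-+ zero    j = ℕ.≤-refl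
⌊/2⌋-+ (suc i) j = ℕ.≤-trans (⌊/2⌋-suc (i ℕ.+ j)) (s≤s (⌊/2⌋-+ i j))

-- Halving i + j gives n + 2, which is at most i + ⌊j/2⌋, and replacing i by its predecessor costs
-- at most 1. The two summands are the degrees gained from ε_i and from the spread sequence at j.
order-bound : ∀ n i j → i ℕ.+ j ≡ suc (suc n) ℕ.+ suc (suc n) → suc n ℕ.≤ ℕ.pred i ℕ.+ ⌊ j /2⌋
order-bound n i j eq = ℕ.≤-pred (ℕ.≤-trans (ℕ.≤-reflexive (≡.trans (≡.sym (half (suc (suc n)))) (≡.cong ⌊_/2⌋ (≡.sym eq))))
  (ℕ.≤-trans (⌊/2⌋-+ i j) (bound i)))
  where
  half : ∀ m → ⌊ m ℕ.+ m /2⌋ ≡ m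
  half m = ≡.sym (ℕ.n≡⌊n+n/2⌋ m)
  bound : ∀ i → i ℕ.+ ⌊ j /2⌋ ℕ.≤ suc (ℕ.pred i ℕ.+ ⌊ j /2⌋)
  bound zero = ℕ.n≤1+n _
  bound (suc i) = ℕ.≤-refl

module Limit {r ℓ : Level} (R : CommutativeRing r ℓ) (α γ δ : PowerSeries.Carrier R)
  (γ₀ : CommutativeRing._≈_ R (γ 0) (CommutativeRing.0# R)) where

  open PowerSeries R
  private
    module R = CommutativeRing R
    module S = CommutativeRing commutativeRing
    open SeriesProperties R
    open Congruence R
    open Fixpoint R
    open FactorStep commutativeRing
    module Conv = PowerSeries commutativeRing
    module SSolver = Solver S.commutativeSemiring

  p P : Carrier
  p = X ^ 2
  P = X ^ 4

  private
    p₀ : p 0 R.≈ R.0#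
    p₀ = R.zeroˡ _

    P₀ : P 0 R.≈ R.0#
    P₀ = R.zeroˡ _

    p^suc : ∀ k → (p ^ suc k) 0 R.≈ R.0#
    p^suc k = 0*-constant {p} (p ^ k) p₀

    P^suc : ∀ k → (P ^ suc k) 0 R.≈ R.0#
    P^suc k = 0*-constant {P} (P ^ k) P₀

  -- Explicitly, ε_j = p^(j(j-1)/2) / (p;p)_j are Euler's coefficients of (-z;p)∞, and β_k = 1 /
  -- (P;P)_k is what u_k becomes when α, γ and δ vanish.
  ε β u t : ℕ → Carrier
  ε zero    = 1#
  ε (suc j) = solution (p ^ suc j) (p ^ j * ε j)
  β zero    = 1#
  β (suc k) = solution (P ^ suc k) (β k)
  u zero    = 1#
  u (suc k) = solution (P ^ suc k) (t k + δ * P ^ k * t k)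
  t k       = solution (γ * P ^ k) (u k + α * P ^ k * u k)

  private
    p*p≈P : p * p ≈ P
    p*p≈P = S.sym {P} {p * p} (Exp.^-homo-* S.semiring X 2 2)

    ε-suc : ∀ j → ε (suc j) ≈ p ^ suc j * ε (suc j) + p ^ j * ε j
    ε-suc j = ⇒fixed {p ^ suc j} {ε (suc j)} {p ^ j * ε j} (solution-* (p ^ j * ε j) (p^suc j))

    t-fixed : ∀ k → t k * (1# - γ * P ^ k) ≈ u k + α * P ^ k * u k
    t-fixed k = solution-* (u k + α * P ^ k * u k) (0*-constant {γ} (P ^ k) γ₀)

    t-def : ∀ k → t k ≈ γ * P ^ k * t k + (u k + α * P ^ k * u k)
    t-def k = ⇒fixed {γ * P ^ k} {t k} {u k + α * P ^ k * u k} (t-fixed k)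

    u-suc : ∀ k → u (suc k) ≈ P ^ suc k * u (suc k) + (t k + δ * P ^ k * t k)
    u-suc k = ⇒fixed {P ^ suc k} {u (suc k)} {t k + δ * P ^ k * t k} (solution-* (t k + δ * P ^ k * t k) (P^suc k))

    β-suc : ∀ k → β (suc k) ≈ P ^ suc k * β (suc k) + β k
    β-suc k = ⇒fixed {P ^ suc k} {β (suc k)} {β k} (solution-* (β k) (P^suc k))

  module Full = ClosedForm commutativeRing p P α γ δ p*p≈P ε u t (S.refl {1#}) ε-suc t-def u-suc
  open Full using (F; J) public

  private
    0-terms : ∀ x y → y ≈ y + 0# * x * y
    0-terms x y = SSolver.solve 2 (λ x y → y SSolver.:=
      y SSolver.:+ SSolver.con 0 SSolver.:* x SSolver.:* y) (λ _ → R.refl) x y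

    -- For α = γ = δ = 0 both `u` and `t` become `β`, and the closed form is (-z;p)∞ / (z²;P)∞ = 1 /
    -- (z;p)∞, whose coefficients are 1 / (p;p)_N.
    module Zero = ClosedForm commutativeRing p P 0# 0# 0# p*p≈P ε β β (S.refl {1#}) ε-suc
      (λ k → S.trans (0-terms (P ^ k) (β k)) (S.trans (S.+-comm (β k) (0# * P ^ k * β k))
               (S.+-congˡ {0# * P ^ k * β k} (0-terms (P ^ k) (β k)))))
      (λ k → S.trans (β-suc k) (S.+-congˡ {P ^ suc k * β (suc k)} (0-terms (P ^ k) (β k))))

    Φ : ℕ → Carrier
    Φ = Zero.F

    -- All terms with a parameter vanish, so the second-order recurrence shrinks to a first-order
    -- one.
    Φ-suc : ∀ N → Φ (suc N) * (1# - p * p ^ N) ≈ Φ N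
    Φ-suc zero = S.trans (S.*-congˡ {Φ 1} (S.+-congˡ {1#} (S.-‿cong {p * 1#} {p} (S.*-identityʳ p))))
      (fixed⇒ {p} {Φ 1} {Φ 0} Zero.F-one)
    Φ-suc (suc k) = S.trans (fixed⇒ {p ^ suc (suc k)} {Φ (suc (suc k))} (Zero.F-suc-suc k))
      (SSolver.solve 4 (λ f x y z → f :+ (con 0 :* x :+ (con 0 :* y :+ con 0 :* z)) := f) (λ _ → R.refl)
        (Φ (suc k)) (p ^ k * Φ k) (p ^ k * Zero.J k) (p ^ k * Zero.J k))
      where open SSolver

    Φ-product : ∀ N → Φ N * ⟨ p ⨾ p ⟩ N ≈ 1#
    Φ-product zero = S.trans (S.*-identityʳ (Φ 0)) Zero.F-zero
    Φ-product (suc N) = S.trans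
      (SSolver.solve 3 (λ f x y → f :* (x :* y) := f :* y :* x) (λ _ → R.refl) (Φ (suc N)) (⟨ p ⨾ p ⟩ N) (1# - p * p ^ N))
      (S.trans (S.*-congʳ {⟨ p ⨾ p ⟩ N} (Φ-suc N)) (Φ-product N))
      where open SSolver

    u-product : ∀ k → u k * ⟨ γ ⨾ P ⟩ k ≈ β k * (⟨ - α ⨾ P ⟩ k * ⟨ - δ ⨾ P ⟩ k)
    u-product zero = S.*-congˡ {1#} (S.sym (S.*-identityˡ 1#))
    u-product (suc k) = S.trans
      (factor-step {u k} {t k} {u (suc k)} {⟨ γ ⨾ P ⟩ k} {1# - γ * P ^ k} {β k} {⟨ - α ⨾ P ⟩ k} {⟨ - δ ⨾ P ⟩ k}
          {1# + α * P ^ k} {δ * P ^ k} {(1# - P ^ suc k) ⁻¹}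
        (u-product k)
        (S.trans (t-fixed k) (SSolver.solve 2 (λ u x → u :+ x :* u := u :* (con 1 :+ x)) (λ _ → R.refl) (u k) (α * P ^ k)))
        (S.refl {u (suc k)}))
      (S.*-congˡ {β (suc k)} (S.*-cong {⟨ - α ⨾ P ⟩ k * (1# + α * P ^ k)} {⟨ - α ⨾ P ⟩ (suc k)}
        {⟨ - δ ⨾ P ⟩ k * (1# + δ * P ^ k)} {⟨ - δ ⨾ P ⟩ (suc k)}
        (S.*-congˡ {⟨ - α ⨾ P ⟩ k} (S.sym (1--x α (P ^ k))))
        (S.*-congˡ {⟨ - δ ⨾ P ⟩ k} (S.sym (1--x δ (P ^ k))))))
      where open SSolver

    numerator : Carrier
    numerator = ⟨ - α ⨾ P ⟩∞ * ⟨ - δ ⨾ P ⟩∞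

    limit : ∀ x y → y 0 R.≈ R.0# → ∀ N → ⟨ x ⨾ y ⟩∞ ≡ ⟨ x ⨾ y ⟩ N [q^ N ]
    limit x y y₀ N n n<N = R.sym (⟨⨾⟩∞-limit x y y₀ n N n<N)

    ≡-sym : ∀ {f g N} → f ≡ g [q^ N ] → g ≡ f [q^ N ]
    ≡-sym eq n n<N = R.sym (eq n n<N)

    -- Cutting a product off after k factors changes nothing below X^k. The factor `β k` is not
    -- approximated, since it occurs in `Φ` as well.
    u-limit : ∀ k → u k * ⟨ γ ⨾ P ⟩∞ ≡ β k * numerator [q^ k ]
    u-limit k = ≡-trans {u k * ⟨ γ ⨾ P ⟩∞} {u k * ⟨ γ ⨾ P ⟩ k} {β k * numerator}
      (*-congˡ-≡ (u k) (limit γ P P₀ k))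
      (≡-trans {u k * ⟨ γ ⨾ P ⟩ k} {β k * (⟨ - α ⨾ P ⟩ k * ⟨ - δ ⨾ P ⟩ k)} {β k * numerator}
        (≈⇒≡ (u-product k))
        (*-congˡ-≡ (β k) (≡-sym {numerator} {⟨ - α ⨾ P ⟩ k * ⟨ - δ ⨾ P ⟩ k} (*-cong-≡ {⟨ - α ⨾ P ⟩∞} (limit (- α) P P₀ k) (limit (- δ) P P₀ k)))))

    -- Each factor p = X² is credited with one degree, which suffices for `order-bound`.
    p^-cong-≡ : ∀ j {f g N} → f ≡ g [q^ N ] → p ^ j * f ≡ p ^ j * g [q^ j ℕ.+ N ]
    p^-cong-≡ zero {f} {g} eq = *-congˡ-≡ 1# eq
    p^-cong-≡ (suc j) {f} {g} eq n n<N = R.trans (regroup f n)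
      (R.trans (X*-cong-≡ {X * (p ^ j * f)} {X * (p ^ j * g)}
        (*-congˡ-≡ X (p^-cong-≡ j eq)) n n<N) (R.sym (regroup g n)))
      where
      open SSolver
      regroup : ∀ f → p ^ suc j * f ≈ X * (X * (p ^ j * f))
      regroup f = solve 3 (λ x y f → x :* (x :* con 1) :* y :* f := x :* (x :* (y :* f))) (λ _ → R.refl) X (p ^ j) f

    -- The gain comes from the factor p^j in ε_(j+1) alone, hence the predecessor in the bound.
    ε-cong-≡ : ∀ j {f g N} → f ≡ g [q^ N ] → ε j * f ≡ ε j * g [q^ ℕ.pred j ℕ.+ N ]
    ε-cong-≡ zero eq = *-congˡ-≡ 1# eq
    ε-cong-≡ (suc j) {f} {g} eq n n<N = R.trans (regroup f n)
      (R.trans (p^-cong-≡ j {ε j * i * f} {ε j * i * g} (*-congˡ-≡ (ε j * i) eq) n n<N) (R.sym (regroup g n)))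
      where
      open SSolver
      i : Carrier
      i = (1# - p ^ suc j) ⁻¹
      regroup : ∀ f → ε (suc j) * f ≈ p ^ j * (ε j * i * f)
      regroup f = solve 4 (λ y e i f → y :* e :* i :* f := y :* (e :* i :* f)) (λ _ → R.refl) (p ^ j) (ε j) i f

    -- Moving on by two places passes to the shifted sequences, whose precision at each k is one
    -- higher; the offset `o` records this.
    spread-cong-≡ : ∀ {f g : ℕ → Carrier} {x y} o → (∀ k → f k * x ≡ g k * y [q^ k ℕ.+ o ]) →
                    ∀ j → spread 0# f j * x ≡ spread 0# g j * y [q^ ⌊ j /2⌋ ℕ.+ o ]
    spread-cong-≡ o eq zero = eq 0
    spread-cong-≡ {x = x} {y} o eq (suc zero) = ≈⇒≡ (S.trans (S.zeroˡ x) (S.sym (S.zeroˡ y)))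
    spread-cong-≡ {f} {g} {x} {y} o eq (suc (suc j)) = ≡.subst (λ N → spread 0# (f ∘ suc) j * x ≡ spread 0# (g ∘ suc) j * y [q^ N ])
      (ℕ.+-suc ⌊ j /2⌋ o)
      (spread-cong-≡ (suc o) (λ k → ≡.subst (λ N → f (suc k) * x ≡ g (suc k) * y [q^ N ]) (≡.sym (ℕ.+-suc k o)) (eq (suc k))) j)

    -- Distributing `x` and `y` over the Cauchy sum reduces the claim to single terms with i + j =
    -- N; the induction shifts only `e`.
    conv-cong-≡ : ∀ {e f g : ℕ → Carrier} {x y M} N → (∀ i j → i ℕ.+ j ≡ N → e i * (f j * x) ≡ e i * (g j * y) [q^ M ]) →
                  (e Conv.* f) N * x ≡ (e Conv.* g) N * y [q^ M ]
    conv-cong-≡ {e} {f} {g} {x} {y} zero eq n n<M = R.trans (S.*-assoc (e 0) (f 0) x n)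
      (R.trans (eq 0 0 ≡.refl n n<M) (R.sym (S.*-assoc (e 0) (g 0) y n)))
    conv-cong-≡ {e} {f} {g} {x} {y} (suc N) eq n n<M = R.trans (split f x n)
      (R.trans (R.+-cong (eq 0 (suc N) ≡.refl n n<M)
          (conv-cong-≡ {e ∘ suc} {f} {g} {x} {y} N (λ i j i+j≡N → eq (suc i) j (≡.cong suc i+j≡N)) n n<M))
        (R.sym (split g y n)))
      where
      split : ∀ f x → (e Conv.* f) (suc N) * x ≈ e 0 * (f (suc N) * x) + ((e ∘ suc) Conv.* f) N * x
      split f x = S.trans (S.distribʳ x (e 0 * f (suc N)) (((e ∘ suc) Conv.* f) N))
        (S.+-congʳ {((e ∘ suc) Conv.* f) N * x} (S.*-assoc (e 0) (f (suc N)) x))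

  -- ε j has order at least j - 1 and u k is known up to order k; both
  -- orders add up to more than n as soon as j + 2k = far n.
  far : ℕ → ℕ
  far n = suc (suc n) ℕ.+ suc (suc n)

  private
    F-limit′ : ∀ n → F (far n) * ⟨ γ ⨾ P ⟩∞ ≡ Φ (far n) * numerator [q^ suc n ]
    F-limit′ n = conv-cong-≡ {ε} {spread 0# u} {spread 0# β} (far n) λ i j i+j≡N →
      ≡-weaken {ε i * (spread 0# u j * ⟨ γ ⨾ P ⟩∞)} (order-bound n i j i+j≡N)
        (ε-cong-≡ i (≡.subst (λ N → spread 0# u j * ⟨ γ ⨾ P ⟩∞ ≡ spread 0# β j * numerator [q^ N ]) (ℕ.+-identityʳ ⌊ j /2⌋)
          (spread-cong-≡ {u} {β} 0 (λ k → ≡.subst (λ N → u k * ⟨ γ ⨾ P ⟩∞ ≡ β k * numerator [q^ N ]) (≡.sym (ℕ.+-identityʳ k)) (u-limit k)) j)))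

  -- Below degree n + 1 the product (p;p)∞ may be replaced by its first `far n` factors, and these
  -- cancel `Φ (far n)` exactly, leaving the numerator.
  F-limit : ∀ n → F (far n) * (⟨ p ⨾ p ⟩∞ * ⟨ γ ⨾ P ⟩∞) ≡ ⟨ - α ⨾ P ⟩∞ * ⟨ - δ ⨾ P ⟩∞ [q^ suc n ]
  F-limit n m m≤n = begin
    (F N * (⟨ p ⨾ p ⟩∞ * g)) m
      ≈⟨ solve 3 (λ f x g → f :* (x :* g) := x :* (f :* g)) (λ _ → R.refl) (F N) ⟨ p ⨾ p ⟩∞ g m ⟩
    (⟨ p ⨾ p ⟩∞ * (F N * g)) m
      ≈⟨ *-cong-≡ {⟨ p ⨾ p ⟩∞} {⟨ p ⨾ p ⟩ N} {F N * g} {Φ N * numerator}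
           (≡-weaken {⟨ p ⨾ p ⟩∞} {⟨ p ⨾ p ⟩ N} (ℕ.≤-trans (ℕ.n≤1+n _) (ℕ.m≤m+n _ _)) (limit p p p₀ N)) (F-limit′ n) m m≤n ⟩
    (⟨ p ⨾ p ⟩ N * (Φ N * numerator)) m
      ≈⟨ solve 3 (λ x f g → x :* (f :* g) := f :* x :* g) (λ _ → R.refl) (⟨ p ⨾ p ⟩ N) (Φ N) numerator m ⟩
    (Φ N * ⟨ p ⨾ p ⟩ N * numerator) m
      ≈⟨ S.trans (S.*-congʳ {numerator} (Φ-product N)) (S.*-identityˡ numerator) m ⟩
    numerator m ∎
    where
    open SSolver
    open SetoidReasoning R.setoid
    N = far n
    g = ⟨ γ ⨾ P ⟩∞

  -- After the initial value, every equation has the form y = x y + s with x free of a constant term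
  -- and s built from known values, so it determines y.
  F-unique : (f j : ℕ → Carrier) → f 0 ≈ 1# → f 1 ≈ p * f 1 + f 0 →
    (∀ k → f (suc (suc k)) ≈ p ^ suc (suc k) * f (suc (suc k)) +
             (f (suc k) + (α * (p ^ k * f k) + (γ * (p ^ k * j k) + δ * (p ^ k * j k))))) →
    j 0 ≈ γ * j 0 + (f 0 + α * f 0) →
    (∀ k → j (suc k) ≈ γ * p ^ suc k * j (suc k) +
             ((f (suc k) + α * (p ^ suc k * f (suc k))) + (α * (p ^ k * f k) + γ * (p ^ k * j k)))) →
    ∀ k → f k ≈ F k
  F-unique f j f-zero f-one f-suc-suc j-zero j-suc k = proj₁ (go k)
    where
    open SSolver
    -- This triple carries the induction: both f (k+2) and j (k+1) are determined by f (k+1), f k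
    -- and j k.
    go : ∀ k → f k ≈ F k × f (suc k) ≈ F (suc k) × j k ≈ J k
    go zero = f₀ , fixed-unique {p} {f 1} {F 1} p₀ f-one Full.F-one f₀
      , fixed-unique {γ} {j 0} {J 0} {f 0 + α * f 0} {F 0 + α * F 0} γ₀ j-zero
          (S.trans Full.J-zero (S.+-comm (F 0 + α * F 0) (γ * J 0)))
          (S.+-cong {f 0} {F 0} {α * f 0} {α * F 0} f₀ (S.*-congˡ {α} f₀))
      where
      f₀ : f 0 ≈ F 0
      f₀ = S.trans f-zero (S.sym Full.F-zero)
    go (suc k) with go k
    ... | fk , fk′ , jk = fk′
      , fixed-unique {p ^ suc (suc k)} {f (suc (suc k))} {F (suc (suc k))} (p^suc (suc k)) (f-suc-suc k) (Full.F-suc-suc k)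
          (S.+-cong {f (suc k)} {F (suc k)} fk′ (S.+-cong {α * (p ^ k * f k)} {α * (p ^ k * F k)} αf
            (S.+-cong {γ * (p ^ k * j k)} {γ * (p ^ k * J k)} γj (S.*-congˡ {δ} (S.*-congˡ {p ^ k} jk)))))
      , fixed-unique {γ * p ^ suc k} {j (suc k)} {J (suc k)} (0*-constant {γ} (p ^ suc k) γ₀) (j-suc k)
          (S.trans (Full.J-suc k) (solve 6 (λ f f′ c y j r → (f :+ f′) :+ (c :* (y :* j) :+ r) := c :* y :* j :+ ((f :+ f′) :+ r)) (λ _ → R.refl)
            (F (suc k)) (α * (p ^ suc k * F (suc k))) γ (p ^ suc k) (J (suc k)) (α * (p ^ k * F k) + γ * (p ^ k * J k))))
          (S.+-cong {f (suc k) + α * (p ^ suc k * f (suc k))} {F (suc k) + α * (p ^ suc k * F (suc k))}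
            (S.+-cong {f (suc k)} {F (suc k)} fk′ (S.*-congˡ {α} (S.*-congˡ {p ^ suc k} fk′)))
            (S.+-cong {α * (p ^ k * f k)} {α * (p ^ k * F k)} αf γj))
      where
      αf : α * (p ^ k * f k) ≈ α * (p ^ k * F k)
      αf = S.*-congˡ {α} (S.*-congˡ {p ^ k} fk)
      γj : γ * (p ^ k * j k) ≈ γ * (p ^ k * J k)
      γj = S.*-congˡ {γ} (S.*-congˡ {p ^ k} jk)

-- Parts arranged by level, with Primc's difference conditions.

module Levels where
  open Colour
  open ≡ using (refl; sym; trans; cong; subst; subst₂)

  -- Dividing sizes by 2 turns the conditions B₂ into Primc's: a part of
  -- level k (and colour x) is followed by one of level l (and colour y)
  -- iff k - l ≥ primc x y.
  part : ℕ → Colour → Part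
  part k a = suc (k ℕ.* 2) ▹ a
  part k b = suc k ℕ.* 2 ▹ b
  part k c = suc k ℕ.* 2 ▹ c
  part k d = suc (suc k ℕ.* 2) ▹ d

  primc : Colour → Colour → ℕ
  primc a b = 1
  primc a _ = 2
  primc b b = 0
  primc b _ = 1
  primc c a = 0
  primc c b = 1
  primc c c = 0
  primc c d = 2
  primc d a = 0
  primc d b = 1
  primc d c = 0
  primc d d = 2

  part-colour : ∀ k x → colour (part k x) ≡ x
  part-colour k a = refl
  part-colour k b = refl
  part-colour k c = refl
  part-colour k d = refl

  part-injective : ∀ k l x y → part k x ≡ part l y → k ≡ l × x ≡ y
  part-injective k l x y eq with trans (sym (part-colour k x)) (trans (cong colour eq) (part-colour l y))
  ... | refl = level x (cong size eq) , refl
    where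
    halve : k ℕ.* 2 ≡ l ℕ.* 2 → k ≡ l
    halve = ℕ.*-cancelʳ-≡ k l 2
    level : ∀ x → size (part k x) ≡ size (part l x) → k ≡ l
    level a eq = halve (ℕ.suc-injective eq)
    level b eq = halve (ℕ.suc-injective (ℕ.suc-injective eq))
    level c eq = halve (ℕ.suc-injective (ℕ.suc-injective eq))
    level d eq = halve (ℕ.suc-injective (ℕ.suc-injective (ℕ.suc-injective eq)))

  offset : Colour → ℕ
  offset a = 1
  offset b = 2
  offset c = 2
  offset d = 3

  size-part : ∀ k x → size (part k x) ≡ offset x ℕ.+ k ℕ.* 2
  size-part k a = refl
  size-part k b = refl
  size-part k c = refl
  size-part k d = refl

  -- Corrected by the offsets, every entry of `B₂` is exactly even. Halving therefore loses nothing,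
  -- and the condition on sizes is equivalent to the one on levels.
  B₂-primc : ∀ x y → B₂ x y ℕ.+ offset y ≡ offset x ℕ.+ primc x y ℕ.* 2
  B₂-primc a a = refl
  B₂-primc a b = refl
  B₂-primc a c = refl
  B₂-primc a d = refl
  B₂-primc b a = refl
  B₂-primc b b = refl
  B₂-primc b c = refl
  B₂-primc b d = refl
  B₂-primc c a = refl
  B₂-primc c b = refl
  B₂-primc c c = refl
  B₂-primc c d = refl
  B₂-primc d a = refl
  B₂-primc d b = refl
  B₂-primc d c = refl
  B₂-primc d d = refl

  gap-sizes : ∀ k x l y →
    B₂ (colour (part k x)) (colour (part l y)) ℕ.+ size (part l y) ≡ offset x ℕ.+ (primc x y ℕ.+ l) ℕ.* 2
  gap-sizes k x l y rewrite part-colour k x | part-colour l y | size-part l y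
    | sym (ℕ.+-assoc (B₂ x y) (offset y) (l ℕ.* 2)) | B₂-primc x y
    | ℕ.*-distribʳ-+ 2 (primc x y) l = ℕ.+-assoc (offset x) (primc x y ℕ.* 2) (l ℕ.* 2)

  gap⇒primc : ∀ k x l y → Gap (part k x) (part l y) → primc x y ℕ.+ l ℕ.≤ k
  gap⇒primc k x l y gap = ℕ.*-cancelʳ-≤ (primc x y ℕ.+ l) k 2
    (ℕ.+-cancelˡ-≤ (offset x) _ _ (subst₂ ℕ._≤_ (gap-sizes k x l y) (size-part k x) gap))

  primc⇒gap : ∀ k x l y → primc x y ℕ.+ l ℕ.≤ k → Gap (part k x) (part l y)
  primc⇒gap k x l y le = subst₂ ℕ._≤_ (sym (gap-sizes k x l y)) (sym (size-part k x))
    (ℕ.+-monoʳ-≤ (offset x) (ℕ.*-monoˡ-≤ 2 le))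

  parity : ∀ s → (∃ λ k → s ≡ k ℕ.* 2) ⊎ (∃ λ k → s ≡ suc (k ℕ.* 2))
  parity zero = inj₁ (0 , refl)
  parity (suc s) with parity s
  ... | inj₁ (k , refl) = inj₂ (k , refl)
  ... | inj₂ (k , refl) = inj₁ (suc k , refl)

  odd-∤ : ∀ k → 2 ∤ suc (k ℕ.* 2)
  odd-∤ k (divides q eq) = go k q eq
    where
    go : ∀ k q → suc (k ℕ.* 2) ≡ q ℕ.* 2 → ⊥
    go zero    (suc q) ()
    go (suc k) (suc q) eq = go k q (ℕ.suc-injective (ℕ.suc-injective eq))

  odd⇒ : ∀ {s} → 2 ∤ s → ∃ λ k → s ≡ suc (k ℕ.* 2)
  odd⇒ {s} 2∤s with parity s
  ... | inj₁ (k , eq) = ⊥-elim (2∤s (divides k eq))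
  ... | inj₂ odd      = odd

  even⇒ : ∀ {s} → 1 ℕ.≤ s → 2 ∣ s → ∃ λ k → s ≡ suc k ℕ.* 2
  even⇒ () (divides zero refl)
  even⇒ _  (divides (suc k) eq) = k , eq

  allowed⇒part : ∀ {p} → AllowedPart p → ∃ λ k → p ≡ part k (colour p)
  allowed⇒part {s ▹ a} (_ , odd , _) with odd⇒ odd
  ... | k , refl = k , refl
  allowed⇒part {s ▹ b} (1≤s , even , _) with even⇒ 1≤s even
  ... | k , refl = k , refl
  allowed⇒part {s ▹ c} (1≤s , even , _) with even⇒ 1≤s even
  ... | k , refl = k , refl
  allowed⇒part {s ▹ d} (_ , odd , ≢1d) with odd⇒ odd
  -- Size 1 is the forbidden part, so level 0 of colour d starts at size 3.
  ... | zero  , refl = ⊥-elim (≢1d refl)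
  ... | suc k , refl = k , refl

  part-allowed : ∀ k x → AllowedPart (part k x)
  part-allowed k a = s≤s z≤n , odd-∤ k , λ ()
  part-allowed k b = s≤s z≤n , divides (suc k) refl , λ ()
  part-allowed k c = s≤s z≤n , divides (suc k) refl , λ ()
  part-allowed k d = s≤s z≤n , odd-∤ (suc k) , λ ()

  -- All parts of level < k; those that may follow part k a; those of
  -- level < k that may follow part k c or part k d.
  below belowᵃ belowᶜ : ℕ → List Part
  below zero     = []
  below (suc k)  = part k d ∷ belowᶜ (suc k)
  belowᵃ zero    = []
  belowᵃ (suc k) = part k b ∷ below k
  belowᶜ zero    = []
  belowᶜ (suc k) = part k a ∷ part k c ∷ belowᵃ (suc k)

  -- Row a of `primc` exceeds row b by one in every column, so `part k b` is followed by what may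
  -- follow colour a at level k + 1. Rows c and d coincide.
  followers : ℕ → Colour → List Part
  followers k a = belowᵃ k
  followers k b = belowᵃ (suc k)
  followers k c = part k a ∷ part k c ∷ belowᶜ k
  followers k d = part k a ∷ part k c ∷ belowᶜ k

  below⇒ : ∀ k {l y} → part l y ∈ below k → l ℕ.< k
  below⇒ (suc k) {l} {y} (here eq) with part-injective l k y d eq
  ... | refl , refl = ℕ.≤-refl
  below⇒ (suc k) {l} {y} (there (here eq)) with part-injective l k y a eq
  ... | refl , refl = ℕ.≤-refl
  below⇒ (suc k) {l} {y} (there (there (here eq))) with part-injective l k y c eq
  ... | refl , refl = ℕ.≤-refl
  below⇒ (suc k) {l} {y} (there (there (there (here eq)))) with part-injective l k y b eq
  ... | refl , refl = ℕ.≤-refl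
  below⇒ (suc k) (there (there (there (there ∈)))) = ℕ.m≤n⇒m≤1+n (below⇒ k ∈)

  ⇒below : ∀ k {l} y → l ℕ.< k → part l y ∈ below k
  ⇒below (suc k) {l} y (s≤s l≤k) with l ℕ.≟ k
  ... | no  l≢k  = there (there (there (there (⇒below k y (ℕ.≤∧≢⇒< l≤k l≢k)))))
  ⇒below (suc k) a _ | yes refl = there (here refl)
  ⇒below (suc k) b _ | yes refl = there (there (there (here refl)))
  ⇒below (suc k) c _ | yes refl = there (there (here refl))
  ⇒below (suc k) d _ | yes refl = here refl

  weaken-primcᵃ : ∀ y {l k} → suc l ℕ.≤ k → primc a y ℕ.+ l ℕ.≤ suc k
  weaken-primcᵃ a le = s≤s le
  weaken-primcᵃ b le = ℕ.m≤n⇒m≤1+n le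
  weaken-primcᵃ c le = s≤s le
  weaken-primcᵃ d le = s≤s le

  belowᵃ⇒ : ∀ k {l y} → part l y ∈ belowᵃ k → primc a y ℕ.+ l ℕ.≤ k
  belowᵃ⇒ (suc k) {l} {y} (here eq) with part-injective l k y b eq
  ... | refl , refl = ℕ.≤-refl
  belowᵃ⇒ (suc k) {l} {y} (there ∈) = weaken-primcᵃ y (below⇒ k ∈)

  ⇒belowᵃ : ∀ k {l} y → primc a y ℕ.+ l ℕ.≤ k → part l y ∈ belowᵃ k
  ⇒belowᵃ (suc k) a (s≤s le) = there (⇒below k a le)
  ⇒belowᵃ (suc k) c (s≤s le) = there (⇒below k c le)
  ⇒belowᵃ (suc k) d (s≤s le) = there (⇒below k d le)
  ⇒belowᵃ (suc k) {l} b (s≤s l≤k) with l ℕ.≟ k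
  ... | yes refl = here refl
  ... | no  l≢k  = there (⇒below k b (ℕ.≤∧≢⇒< l≤k l≢k))

  -- The maximum of 1 and `primc c y`, because `belowᶜ` also demands a strictly smaller level.
  boundᶜ : Colour → ℕ
  boundᶜ d = 2
  boundᶜ _ = 1

  belowᶜ⇒ : ∀ k {l y} → part l y ∈ belowᶜ k → boundᶜ y ℕ.+ l ℕ.≤ k
  belowᶜ⇒ (suc k) {l} {y} (here eq) with part-injective l k y a eq
  ... | refl , refl = ℕ.≤-refl
  belowᶜ⇒ (suc k) {l} {y} (there (here eq)) with part-injective l k y c eq
  ... | refl , refl = ℕ.≤-refl
  belowᶜ⇒ (suc k) {l} {y} (there (there ∈)) = weaken y (belowᵃ⇒ (suc k) ∈)
    where
    weaken : ∀ y → primc a y ℕ.+ l ℕ.≤ suc k → boundᶜ y ℕ.+ l ℕ.≤ suc k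
    weaken a le = ℕ.<⇒≤ le
    weaken b le = le
    weaken c le = ℕ.<⇒≤ le
    weaken d le = le

  ⇒belowᶜ : ∀ k {l} y → boundᶜ y ℕ.+ l ℕ.≤ k → part l y ∈ belowᶜ k
  ⇒belowᶜ (suc k) b le = there (there (⇒belowᵃ (suc k) b le))
  ⇒belowᶜ (suc k) d le = there (there (⇒belowᵃ (suc k) d le))
  ⇒belowᶜ (suc k) {l} a (s≤s l≤k) with l ℕ.≟ k
  ... | yes refl = here refl
  ... | no  l≢k  = there (there (⇒belowᵃ (suc k) a (s≤s (ℕ.≤∧≢⇒< l≤k l≢k))))
  ⇒belowᶜ (suc k) {l} c (s≤s l≤k) with l ℕ.≟ k
  ... | yes refl = there (here refl)
  ... | no  l≢k  = there (there (⇒belowᵃ (suc k) c (s≤s (ℕ.≤∧≢⇒< l≤k l≢k))))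

  weaken-boundᶜ : ∀ y {l k} → boundᶜ y ℕ.+ l ℕ.≤ k → primc c y ℕ.+ l ℕ.≤ k
  weaken-boundᶜ a le = ℕ.<⇒≤ le
  weaken-boundᶜ b le = le
  weaken-boundᶜ c le = ℕ.<⇒≤ le
  weaken-boundᶜ d le = le

  primc-d : ∀ y → primc d y ≡ primc c y
  primc-d a = refl
  primc-d b = refl
  primc-d c = refl
  primc-d d = refl

  followersᶜ⇒ : ∀ k {l y} → part l y ∈ followers k c → primc c y ℕ.+ l ℕ.≤ k
  followersᶜ⇒ k {l} {y} (here eq) with part-injective l k y a eq
  ... | refl , refl = ℕ.≤-refl
  followersᶜ⇒ k {l} {y} (there (here eq)) with part-injective l k y c eq
  ... | refl , refl = ℕ.≤-refl
  followersᶜ⇒ k {l} {y} (there (there ∈)) = weaken-boundᶜ y (belowᶜ⇒ k ∈)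

  ⇒followersᶜ : ∀ k {l} y → primc c y ℕ.+ l ℕ.≤ k → part l y ∈ followers k c
  ⇒followersᶜ k {l} a le with l ℕ.≟ k
  ... | yes refl = here refl
  ... | no  l≢k  = there (there (⇒belowᶜ k a (ℕ.≤∧≢⇒< le l≢k)))
  ⇒followersᶜ k b le = there (there (⇒belowᶜ k b le))
  ⇒followersᶜ k {l} c le with l ℕ.≟ k
  ... | yes refl = there (here refl)
  ... | no  l≢k  = there (there (⇒belowᶜ k c (ℕ.≤∧≢⇒< le l≢k)))
  ⇒followersᶜ k d le = there (there (⇒belowᶜ k d le))

  followers⇒ : ∀ k x {l y} → part l y ∈ followers k x → primc x y ℕ.+ l ℕ.≤ k
  followers⇒ k a ∈ = belowᵃ⇒ k ∈
  followers⇒ k b {l} {y} ∈ = lower y (belowᵃ⇒ (suc k) ∈)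
    where
    lower : ∀ y → primc a y ℕ.+ l ℕ.≤ suc k → primc b y ℕ.+ l ℕ.≤ k
    lower a (s≤s le) = le
    lower b (s≤s le) = le
    lower c (s≤s le) = le
    lower d (s≤s le) = le
  followers⇒ k c ∈ = followersᶜ⇒ k ∈
  followers⇒ k d {l} {y} ∈ = subst (λ m → m ℕ.+ l ℕ.≤ k) (sym (primc-d y)) (followersᶜ⇒ k ∈)

  ⇒followers : ∀ k x {l} y → primc x y ℕ.+ l ℕ.≤ k → part l y ∈ followers k x
  ⇒followers k a y le = ⇒belowᵃ k y le
  ⇒followers k b a le = ⇒belowᵃ (suc k) a (s≤s le)
  ⇒followers k b b le = ⇒belowᵃ (suc k) b (s≤s le)
  ⇒followers k b c le = ⇒belowᵃ (suc k) c (s≤s le)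
  ⇒followers k b d le = ⇒belowᵃ (suc k) d (s≤s le)
  ⇒followers k c y le = ⇒followersᶜ k y le
  ⇒followers k d {l} y le = ⇒followersᶜ k y (subst (λ m → m ℕ.+ l ℕ.≤ k) (primc-d y) le)

  -- Admissible sequences sorted by their first part.

  HeadIn : List Part → List Part → Set
  HeadIn cs []      = ⊤
  HeadIn cs (p ∷ _) = p ∈ cs

  headIn? : ∀ cs → Decidable (HeadIn cs)
  headIn? cs []      = yes tt
  headIn? cs (p ∷ _) = p ∈? cs
    where open DecMembership _≟ᵖ_ using (_∈?_)

  AdmissibleFrom : List Part → ℕ → List Part → Set
  AdmissibleFrom cs n ps = AdmissibleOf n ps × HeadIn cs ps

  admissibleFrom : ∀ cs n → Enumeration (AdmissibleFrom cs n)
  admissibleFrom cs n = refine (λ ps → admissibleOf? n ps ×-dec headIn? cs ps) proj₁ (admissibleOf n)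

  -- Duplicate-free lists with the same members are permutations of each other. Hence an explicit
  -- enumeration may replace a filtered one whenever only sums over the list matter.
  enumeration-↭ : {A : Set} {P Q : A → Set} (E : Enumeration P) (E′ : Enumeration Q) →
                  (∀ {x} → P x → Q x) → (∀ {x} → Q x → P x) → elements E ↭ elements E′
  enumeration-↭ E E′ P⇒Q Q⇒P = ∼bag⇒↭ (unique∧set⇒bag (unique E) (unique E′)
    (mk⇔ (λ x∈ → complete E′ (P⇒Q (sound E x∈))) (λ x∈ → complete E (Q⇒P (sound E′ x∈)))))

  module _ {A : Set} where

    -- The list counterpart of multiplication by X^s.
    delay : ℕ → (ℕ → List A) → ℕ → List A
    delay zero    L n       = L n
    delay (suc s) L zero    = []
    delay (suc s) L (suc n) = delay s L n

    delay-unique : ∀ s {L} → (∀ n → Unique (L n)) → ∀ n → Unique (delay s L n)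
    delay-unique zero    L! n       = L! n
    delay-unique (suc s) L! zero    = []
    delay-unique (suc s) L! (suc n) = delay-unique s L! n

    ∈-delay⁻ : ∀ s {L} n {x} → x ∈ delay s L n → ∃ λ m → n ≡ s ℕ.+ m × x ∈ L m
    ∈-delay⁻ zero    n       x∈ = n , refl , x∈
    ∈-delay⁻ (suc s) (suc n) x∈ with ∈-delay⁻ s n x∈
    ... | m , refl , x∈L = m , refl , x∈L

    ∈-delay⁺ : ∀ s {L} m {x} → x ∈ L m → x ∈ delay s L (s ℕ.+ m)
    ∈-delay⁺ zero    m x∈ = x∈
    ∈-delay⁺ (suc s) m x∈ = ∈-delay⁺ s m x∈

  startingWith : ∀ k x n → List (List Part)
  startingWith k x n = map (part k x ∷_) (delay (size (part k x)) (λ m → elements (admissibleFrom (followers k x) m)) n)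

  ∈-startingWith⁻ : ∀ k x n {ps} → ps ∈ startingWith k x n → ∃ λ qs → ps ≡ part k x ∷ qs × AdmissibleOf n ps
  ∈-startingWith⁻ k x n ps∈ with ∈-map⁻ (part k x ∷_) ps∈
  ... | qs , qs∈ , refl with ∈-delay⁻ (size (part k x)) n qs∈
  ... | m , refl , qs∈E with sound (admissibleFrom (followers k x) m) qs∈E
  ... | ((allowed , linked) , refl) , head = qs , refl , ((part-allowed k x ∷ allowed , link qs allowed linked head) , refl)
    where
    link : ∀ qs → All AllowedPart qs → Linked Gap qs → HeadIn (followers k x) qs → Linked Gap (part k x ∷ qs)
    link []       _             _      _   = [-]
    link (q ∷ qs) (allowed ∷ _) linked q∈ with allowed⇒part allowed
    ... | l , eq = subst (Gap (part k x)) (sym eq)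
      (primc⇒gap k x l (colour q) (followers⇒ k x (subst (_∈ followers k x) eq q∈))) ∷ linked

  ∈-startingWith⁺ : ∀ k x n {qs} → AdmissibleOf n (part k x ∷ qs) → part k x ∷ qs ∈ startingWith k x n
  ∈-startingWith⁺ k x _ {qs} ((_ ∷ allowed , linked) , refl) = ∈-map⁺ (part k x ∷_)
    (∈-delay⁺ (size (part k x)) (weight qs) (complete (admissibleFrom (followers k x) (weight qs))
      (((allowed , unlink linked) , refl) , head qs allowed linked)))
    where
    unlink : ∀ {qs} → Linked Gap (part k x ∷ qs) → Linked Gap qs
    unlink [-]           = []
    unlink (_ ∷ linked) = linked
    head : ∀ qs → All AllowedPart qs → Linked Gap (part k x ∷ qs) → HeadIn (followers k x) qs
    head [] _ _ = tt
    head (q ∷ qs) (allowed ∷ _) (gap ∷ _) with allowed⇒part allowed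
    ... | l , eq = subst (_∈ followers k x) (sym eq)
      (⇒followers k x (colour q) (gap⇒primc k x l (colour q) (subst (Gap (part k x)) eq gap)))

  -- A sequence either begins with `part k x` or not, the empty one being of the second kind. Since
  -- the part is not in `cs`, the kinds are disjoint and the concatenation has no duplicates.
  admissibleFrom-∷ : ∀ k x {cs} n → part k x ∉ cs →
    elements (admissibleFrom (part k x ∷ cs) n) ↭ elements (admissibleFrom cs n) ++ startingWith k x n
  admissibleFrom-∷ k x {cs} n p∉cs = enumeration-↭ (admissibleFrom (part k x ∷ cs) n) split id id
    where
    p = part k x
    E = admissibleFrom cs n
    sound′ : ∀ {ps} → ps ∈ elements E ++ startingWith k x n → AdmissibleFrom (p ∷ cs) n ps
    sound′ {ps} ps∈ with ∈-++⁻ (elements E) ps∈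
    ... | inj₁ ps∈E with sound E ps∈E
    ...   | adm , head = adm , weakenHead ps head
      where
      weakenHead : ∀ ps → HeadIn cs ps → HeadIn (p ∷ cs) ps
      weakenHead []      _  = tt
      weakenHead (_ ∷ _) ∈ = there ∈
    sound′ ps∈ | inj₂ ps∈P with ∈-startingWith⁻ k x n ps∈P
    ... | qs , refl , adm = adm , here refl
    complete′ : ∀ {ps} → AdmissibleFrom (p ∷ cs) n ps → ps ∈ elements E ++ startingWith k x n
    complete′ {[]}     (adm , _)          = ∈-++⁺ˡ (complete E (adm , tt))
    complete′ {_ ∷ _} (adm , there q∈)   = ∈-++⁺ˡ (complete E (adm , q∈))
    complete′ {_ ∷ _} (adm , here refl)  = ∈-++⁺ʳ (elements E) (∈-startingWith⁺ k x n adm)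
    split : Enumeration (AdmissibleFrom (p ∷ cs) n)
    split = record
      { elements = elements E ++ startingWith k x n
      ; unique   = ++⁺ (unique E)
          (map⁺ ∷-injectiveʳ (delay-unique (size p) (λ m → unique (admissibleFrom (followers k x) m)) n))
          (λ { (ps∈E , ps∈P) → disjoint ps∈E (∈-startingWith⁻ k x n ps∈P) })
      ; sound    = sound′
      ; complete = complete′
      }
      where
      disjoint : ∀ {ps} → ps ∈ elements E → (∃ λ qs → ps ≡ p ∷ qs × AdmissibleOf n ps) → ⊥
      disjoint ps∈E (qs , refl , _) = p∉cs (proj₂ (sound E ps∈E))

  admissibleFrom-[]-zero : elements (admissibleFrom [] 0) ↭ [] ∷ []
  admissibleFrom-[]-zero = enumeration-↭ (admissibleFrom [] 0) empty id id
    where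
    empty : Enumeration (AdmissibleFrom [] 0)
    empty = record
      { elements = [] ∷ []
      ; unique   = [] ∷ []
      ; sound    = λ { (here refl) → (([] , []) , refl) , tt }
      ; complete = λ { {[]} _ → here refl ; {_ ∷ _} (_ , ()) }
      }

  admissibleFrom-[]-suc : ∀ n → elements (admissibleFrom [] (suc n)) ↭ []
  admissibleFrom-[]-suc n = enumeration-↭ (admissibleFrom [] (suc n)) empty id id
    where
    empty : Enumeration (AdmissibleFrom [] (suc n))
    empty = record
      { elements = []
      ; unique   = []
      ; sound    = λ ()
      ; complete = λ { {[]} ((_ , ()) , _) ; {_ ∷ _} (_ , ()) }
      }

  -- A part of size at most n has a level low enough to follow `part k a` once k > n, so restricting
  -- the head excludes nothing.
  belowᵃ-exhaustive : ∀ n k → n ℕ.< k → elements (admissibleOf n) ↭ elements (admissibleFrom (belowᵃ k) n)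
  belowᵃ-exhaustive n k n<k = enumeration-↭ (admissibleOf n) (admissibleFrom (belowᵃ k) n)
    (λ {ps} adm → adm , head ps adm) proj₁
    where
    level-bound : ∀ l x → primc a x ℕ.+ l ℕ.≤ suc (size (part l x))
    level-bound l a = s≤s (s≤s (ℕ.m≤m*n l 2))
    level-bound l b = s≤s (ℕ.≤-trans (ℕ.m≤m*n l 2) (ℕ.m≤n+m _ 2))
    level-bound l c = s≤s (s≤s (ℕ.≤-trans (ℕ.m≤m*n l 2) (ℕ.m≤n+m _ 1)))
    level-bound l d = s≤s (s≤s (ℕ.≤-trans (ℕ.m≤m*n l 2) (ℕ.m≤n+m _ 2)))
    head : ∀ ps → AdmissibleOf n ps → HeadIn (belowᵃ k) ps
    head [] _ = tt
    head (p ∷ ps) ((allowed ∷ _ , _) , weight≡n) with allowed⇒part allowed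
    ... | l , eq = subst (_∈ belowᵃ k) (sym eq) (⇒belowᵃ k (colour p)
      (ℕ.≤-trans (level-bound l (colour p)) (ℕ.≤-trans
        (s≤s (ℕ.≤-trans (ℕ.≤-reflexive (cong size (sym eq))) (ℕ.m+n≤o⇒m≤o (size p) (ℕ.≤-reflexive weight≡n)))) n<k)))

  b∉below : ∀ k → part k b ∉ below k
  b∉below k ∈ = ℕ.<-irrefl refl (below⇒ k {k} {b} ∈)

  c∉belowᵃ : ∀ k → part k c ∉ belowᵃ (suc k)
  c∉belowᵃ k ∈ = ℕ.<-irrefl refl (belowᵃ⇒ (suc k) {k} {c} ∈)

  a∉belowᵃ : ∀ k → part k a ∉ part k c ∷ belowᵃ (suc k)
  a∉belowᵃ k (there ∈) = ℕ.<-irrefl refl (belowᵃ⇒ (suc k) {k} {a} ∈)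

  d∉belowᶜ : ∀ k → part k d ∉ belowᶜ (suc k)
  d∉belowᶜ k ∈ = ℕ.<-irrefl refl (belowᶜ⇒ (suc k) {k} {d} ∈)

  c∉belowᶜ : ∀ k → part k c ∉ belowᶜ k
  c∉belowᶜ k ∈ = ℕ.<-irrefl refl (belowᶜ⇒ k {k} {c} ∈)

  a∉belowᶜ : ∀ k → part k a ∉ part k c ∷ belowᶜ k
  a∉belowᶜ k (there ∈) = ℕ.<-irrefl refl (belowᶜ⇒ k {k} {a} ∈)

open Levels

-- Generating functions with weighted colours, and their recurrences.

module ListSum {r ℓ : Level} (R : CommutativeRing r ℓ) {A : Set} (f : A → CommutativeRing.Carrier R) where
  open CommutativeRing R
  open Solver commutativeSemiring

  Σ : List A → Carrier
  Σ []       = 0#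
  Σ (x ∷ xs) = f x + Σ xs

  Σ-++ : ∀ xs ys → Σ (xs ++ ys) ≈ Σ xs + Σ ys
  Σ-++ []       ys = sym (+-identityˡ _)
  Σ-++ (x ∷ xs) ys = trans (+-congˡ (Σ-++ xs ys)) (sym (+-assoc _ _ _))

  Σ-↭ : ∀ {xs ys} → xs ↭ ys → Σ xs ≈ Σ ys
  Σ-↭ ↭.refl           = refl
  Σ-↭ (↭.prep x p)     = +-congˡ (Σ-↭ p)
  Σ-↭ (↭.swap {xs} {ys} x y p) = trans (+-congˡ (+-congˡ (Σ-↭ p)))
    (solve 3 (λ x y s → x :+ (y :+ s) := y :+ (x :+ s)) refl (f x) (f y) (Σ ys))
  Σ-↭ (↭.trans p q)    = trans (Σ-↭ p) (Σ-↭ q)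

module GeneratingFunction {r ℓ : Level} (R : CommutativeRing r ℓ)
  (a₀ c₀ d₀ : CommutativeRing.Carrier R) where

  open Colour
  open PowerSeries R
  private
    module R = CommutativeRing R
    module S = CommutativeRing commutativeRing
    module SSolver = Solver S.commutativeSemiring
    open SeriesProperties R
    open Congruence R

  -- The weights are parameters so that one computation yields both the refined count (variables a,
  -- c, d) and the plain count (all weights 1).
  colourWeight : Colour → R.Carrier
  colourWeight a = a₀
  colourWeight b = R.1#
  colourWeight c = c₀
  colourWeight d = d₀

  monomial : List Part → R.Carrier
  monomial []       = R.1#
  monomial (p ∷ ps) = colourWeight (colour p) R.* monomial ps

  open ListSum R monomial

  total : Carrier
  total n = Σ (elements (admissibleOf n))

  gf : List Part → Carrier
  gf cs n = Σ (elements (admissibleFrom cs n))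

  partWeight : ℕ → Colour → Carrier
  partWeight k x = const (colourWeight x) * X ^ size (part k x)

  Σ-map-∷ : ∀ p pss → Σ (map (p ∷_) pss) R.≈ colourWeight (colour p) R.* Σ pss
  Σ-map-∷ p []         = R.sym (R.zeroʳ _)
  Σ-map-∷ p (ps ∷ pss) = R.trans (R.+-congˡ (Σ-map-∷ p pss)) (R.sym (R.distribˡ _ _ _))

  Σ-delay : ∀ s L n → Σ (delay s L n) R.≈ (X ^ s * (λ m → Σ (L m))) n
  Σ-delay zero L n = R.sym (S.*-identityˡ (λ m → Σ (L m)) n)
  Σ-delay (suc s) L zero = R.sym (R.trans (S.*-assoc X (X ^ s) (λ m → Σ (L m)) 0) (X*-zero (X ^ s * (λ m → Σ (L m)))))
  Σ-delay (suc s) L (suc n) = R.trans (Σ-delay s L n)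
    (R.sym (R.trans (S.*-assoc X (X ^ s) (λ m → Σ (L m)) (suc n)) (X*-suc (X ^ s * (λ m → Σ (L m))) n)))

  -- Prepending a part multiplies monomials by its colour weight, and the delay by its size
  -- multiplies the series by that power of X.
  gf-∷ : ∀ k x {cs} → part k x ∉ cs → gf (part k x ∷ cs) ≈ gf cs + partWeight k x * gf (followers k x)
  gf-∷ k x {cs} p∉cs n = begin
    gf (part k x ∷ cs) n               ≈⟨ Σ-↭ (admissibleFrom-∷ k x n p∉cs) ⟩
    Σ (elements (admissibleFrom cs n) ++ startingWith k x n) ≈⟨ Σ-++ (elements (admissibleFrom cs n)) (startingWith k x n) ⟩
    gf cs n R.+ Σ (startingWith k x n) ≈⟨ R.+-congˡ (Σ-map-∷ (part k x) (delay s L n)) ⟩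
    gf cs n R.+ colourWeight (colour (part k x)) R.* Σ (delay s L n)
      ≈⟨ R.+-congˡ (R.*-cong (R.reflexive (≡.cong colourWeight (part-colour k x))) (Σ-delay s L n)) ⟩
    gf cs n R.+ w R.* (X ^ s * gf (followers k x)) n ≈⟨ R.+-congˡ (R.sym (const* w (X ^ s * gf (followers k x)) n)) ⟩
    gf cs n R.+ (const w * (X ^ s * gf (followers k x))) n
      ≈⟨ R.+-congˡ (R.sym (S.*-assoc (const w) (X ^ s) (gf (followers k x)) n)) ⟩
    gf cs n R.+ (partWeight k x * gf (followers k x)) n ∎
    where
    open SetoidReasoning R.setoid
    s = size (part k x)
    w = colourWeight x
    L : ℕ → List (List Part)
    L m = elements (admissibleFrom (followers k x) m)

  gf-[] : gf [] ≈ 1#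
  gf-[] zero    = R.trans (Σ-↭ admissibleFrom-[]-zero) (R.+-identityʳ _)
  gf-[] (suc n) = Σ-↭ (admissibleFrom-[]-suc n)

  -- The weights of the level 0 parts of colours a, c and d; at level k each is multiplied by p^k.
  α γ δ : Carrier
  α = const a₀ * X
  γ = const c₀ * X ^ 2
  δ = const d₀ * X ^ 3

  private
    γ₀ : γ 0 R.≈ R.0#
    γ₀ = R.trans (R.*-congˡ (R.zeroˡ _)) (R.zeroʳ _)

    module Sol = Limit R α γ δ γ₀
  open Sol using (p; P; F; far; F-limit; F-unique)

  private
    -- `f` and `j` are to be identified with F_k and J_k. The parts of one level are adjoined in the
    -- order b, c, a, d: `f` is the stage after b, `h` after a, `g` after d.
    f g h j : ℕ → Carrier
    f k = gf (belowᵃ k)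
    g k = gf (below k)
    h k = gf (belowᶜ k)
    j k = gf (followers k c)

    open SSolver

    even-power : ∀ k → X ^ (k ℕ.* 2) ≈ p ^ k
    even-power k = S.trans (S.reflexive (≡.cong (X ^_) (ℕ.*-comm k 2))) (S.sym (Exp.^-assocʳ S.semiring X 2 k))

    weight-b : ∀ k s → partWeight k b * s ≈ p ^ suc k * s
    weight-b k s = S.*-congʳ {s} (S.trans (S.*-identityˡ (X ^ size (part k b))) (even-power (suc k)))

    weight-a : ∀ k s → partWeight k a * s ≈ α * (p ^ k * s)
    weight-a k s = S.trans
      (solve 4 (λ w x y s → w :* (x :* y) :* s := w :* x :* (y :* s)) (λ _ → R.refl) (const a₀) X (X ^ (k ℕ.* 2)) s)
      (S.*-congˡ {α} (S.*-congʳ {s} (even-power k)))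

    weight-c : ∀ k s → partWeight k c * s ≈ γ * (p ^ k * s)
    weight-c k s = S.trans
      (solve 4 (λ w x y s → w :* (x :* (x :* y)) :* s := w :* (x :* (x :* con 1)) :* (y :* s)) (λ _ → R.refl) (const c₀) X (X ^ (k ℕ.* 2)) s)
      (S.*-congˡ {γ} (S.*-congʳ {s} (even-power k)))

    weight-d : ∀ k s → partWeight k d * s ≈ δ * (p ^ k * s)
    weight-d k s = S.trans
      (solve 4 (λ w x y s → w :* (x :* (x :* (x :* y))) :* s := w :* (x :* (x :* (x :* con 1))) :* (y :* s)) (λ _ → R.refl) (const d₀) X (X ^ (k ℕ.* 2)) s)
      (S.*-congˡ {δ} (S.*-congʳ {s} (even-power k)))

    -- Equal parts of colour b may repeat, so what follows `part k b` is again counted by f (k+1).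
    f-step : ∀ k → f (suc k) ≈ p ^ suc k * f (suc k) + g k
    f-step k = S.trans (gf-∷ k b (b∉below k)) (S.trans (S.+-congˡ {g k} (weight-b k (f (suc k))))
      (S.+-comm (g k) (p ^ suc k * f (suc k))))

    h-step : ∀ k → h (suc k) ≈ f (suc k) + γ * (p ^ k * j k) + α * (p ^ k * f k)
    h-step k = S.trans (gf-∷ k a (a∉belowᵃ k)) (S.+-cong {gf (part k c ∷ belowᵃ (suc k))} {f (suc k) + γ * (p ^ k * j k)}
      (S.trans (gf-∷ k c (c∉belowᵃ k)) (S.+-congˡ {f (suc k)} (weight-c k (j k)))) (weight-a k (f k)))

    g-step : ∀ k → g (suc k) ≈ f (suc k) + (α * (p ^ k * f k) + (γ * (p ^ k * j k) + δ * (p ^ k * j k)))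
    g-step k = S.trans (gf-∷ k d (d∉belowᶜ k)) (S.trans
      (S.+-cong {h (suc k)} {f (suc k) + γ * (p ^ k * j k) + α * (p ^ k * f k)} (h-step k) (weight-d k (j k)))
      (solve 4 (λ f x y z → f :+ x :+ y :+ z := f :+ (y :+ (x :+ z))) (λ _ → R.refl)
        (f (suc k)) (γ * (p ^ k * j k)) (α * (p ^ k * f k)) (δ * (p ^ k * j k))))

    j-step : ∀ k → j k ≈ h k + γ * (p ^ k * j k) + α * (p ^ k * f k)
    j-step k = S.trans (gf-∷ k a (a∉belowᶜ k)) (S.+-cong {gf (part k c ∷ belowᶜ k)} {h k + γ * (p ^ k * j k)}
      (S.trans (gf-∷ k c (c∉belowᶜ k)) (S.+-congˡ {h k} (weight-c k (j k)))) (weight-a k (f k)))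

    f≈F : ∀ k → f k ≈ F k
    f≈F = F-unique f j gf-[]
      -- `g 0`, and likewise `h 0` in the equation for `j 0`, is `gf []` by computation, as is
      -- `f 0`.
      (S.trans (f-step 0) (S.+-congʳ {g 0} (S.*-congʳ {f 1} (S.*-identityʳ p))))
      (λ k → S.trans (f-step (suc k)) (S.+-congˡ {p ^ suc (suc k) * f (suc (suc k))} (g-step k)))
      (S.trans (j-step 0) (solve 4 (λ f γ j α → f :+ γ :* (con 1 :* j) :+ α :* (con 1 :* f) := γ :* j :+ (f :+ α :* f)) (λ _ → R.refl)
        (f 0) γ (j 0) α))
      (λ k → S.trans (j-step (suc k)) (S.trans
        (S.+-congʳ {α * (p ^ suc k * f (suc k))} (S.+-congʳ {γ * (p ^ suc k * j (suc k))} (h-step k)))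
        (solve 7 (λ f x y γ z j w → f :+ x :+ y :+ γ :* (z :* j) :+ w := γ :* z :* j :+ ((f :+ w) :+ (y :+ x))) (λ _ → R.refl)
          (f (suc k)) (γ * (p ^ k * j k)) (α * (p ^ k * f k)) γ (p ^ suc k) (j (suc k)) (α * (p ^ suc k * f (suc k))))))

    n<far : ∀ n → n ℕ.< far n
    n<far n = ℕ.≤-trans (ℕ.n≤1+n _) (ℕ.m≤m+n _ _)

    total≡F : ∀ n → total ≡ F (far n) [q^ suc n ]
    total≡F n m (s≤s m≤n) = R.trans (Σ-↭ (belowᵃ-exhaustive m (far n) (ℕ.≤-<-trans m≤n (n<far n)))) (f≈F (far n) m)

  denominator : Carrier
  denominator = ⟨ X ^ 2 ⨾ X ^ 2 ⟩∞ * ⟨ const c₀ * X ^ 2 ⨾ X ^ 4 ⟩∞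

  denominator-constant : denominator 0 R.≈ R.1#
  denominator-constant = R.trans (R.*-cong (⟨⨾⟩∞-constant p p (R.zeroˡ _)) (⟨⨾⟩∞-constant γ P γ₀)) (R.*-identityˡ _)

  -- Coefficient n is compared by means of F at index `far n`: below degree n + 1 this is the full
  -- count and the limit formula holds.
  total-* : total * denominator ≈ ⟨ - (const a₀ * X) ⨾ X ^ 4 ⟩∞ * ⟨ - (const d₀ * X ^ 3) ⨾ X ^ 4 ⟩∞
  total-* n = R.trans (*-congʳ-≡ denominator {total} {F (far n)} (total≡F n) n ℕ.≤-refl) (F-limit n n ℕ.≤-refl)

  total-/ : total ≈ (⟨ - (const a₀ * X) ⨾ X ^ 4 ⟩∞ * ⟨ - (const d₀ * X ^ 3) ⨾ X ^ 4 ⟩∞)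
                      / (⟨ X ^ 2 ⨾ X ^ 2 ⟩∞ * ⟨ const c₀ * X ^ 2 ⨾ X ^ 4 ⟩∞)
  total-/ = Fixpoint.*-cancel R {denominator} {total} denominator-constant total-*

-- Euler's product identity for the case of all weights 1.

module EulerStep {r ℓ : Level} (R : CommutativeRing r ℓ) where
  open CommutativeRing R
  open RingProperties ring using (-‿distribʳ-*)
  open SetoidReasoning setoid
  open Solver commutativeSemiring

  difference-of-squares : ∀ x → (1# + x) * (1# - x) ≈ 1# - x * x
  difference-of-squares x = begin
    (1# + x) * (1# - x)        ≈⟨ solve 2 (λ x m → (con 1 :+ x) :* (con 1 :+ m) := con 1 :+ (x :+ (m :+ x :* m))) refl x (- x) ⟩
    1# + (x + (- x + x * - x)) ≈⟨ +-congˡ (sym (+-assoc x (- x) (x * - x))) ⟩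
    1# + (x - x + x * - x)     ≈⟨ +-congˡ (trans (+-congʳ (-‿inverseʳ x)) (+-identityˡ _)) ⟩
    1# + x * - x               ≈⟨ +-congˡ (sym (-‿distribʳ-* x x)) ⟩
    1# - x * x                 ∎

  -- Here x₁ to x₄ are the next four factors of (X;X): those with odd exponent combine with the
  -- numerator, those with even exponent extend (p;p).
  euler-step : ∀ {A D Q E G a d x₁ x₂ x₃ x₄ e₁ e₂ g₁ g₂} → A * D * Q ≈ E * G →
    a * x₁ ≈ g₁ → d * x₃ ≈ g₂ → x₂ ≈ e₁ → x₄ ≈ e₂ →
    A * a * (D * d) * (Q * x₁ * x₂ * x₃ * x₄) ≈ E * e₁ * e₂ * (G * g₁ * g₂)
  euler-step {A} {D} {Q} {E} {G} {a} {d} {x₁} {x₂} {x₃} {x₄} {e₁} {e₂} {g₁} {g₂} ih p₁ p₃ p₂ p₄ = begin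
    A * a * (D * d) * (Q * x₁ * x₂ * x₃ * x₄)
      ≈⟨ solve 9 (λ A D Q a d x₁ x₂ x₃ x₄ → A :* a :* (D :* d) :* (Q :* x₁ :* x₂ :* x₃ :* x₄)
            := A :* D :* Q :* (a :* x₁ :* (d :* x₃) :* (x₂ :* x₄))) refl A D Q a d x₁ x₂ x₃ x₄ ⟩
    A * D * Q * (a * x₁ * (d * x₃) * (x₂ * x₄))
      ≈⟨ *-cong ih (*-cong (*-cong p₁ p₃) (*-cong p₂ p₄)) ⟩
    E * G * (g₁ * g₂ * (e₁ * e₂))
      ≈⟨ solve 6 (λ E G e₁ e₂ g₁ g₂ → E :* G :* (g₁ :* g₂ :* (e₁ :* e₂)) := E :* e₁ :* e₂ :* (G :* g₁ :* g₂)) refl E G e₁ e₂ g₁ g₂ ⟩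
    E * e₁ * e₂ * (G * g₁ * g₂) ∎

module Euler {r ℓ : Level} (R : CommutativeRing r ℓ) where
  private
    module R = CommutativeRing R
  open PowerSeries R
  private
    module S = CommutativeRing commutativeRing
    open EulerStep commutativeRing
    open FactorStep commutativeRing
    open Congruence R
    open Exp S.semiring using (^-assocʳ)
    module SSolver = Solver S.commutativeSemiring
    open SSolver
    open GeneratingFunction R R.1# R.1# R.1# using (α; γ; δ)

    p P : Carrier
    p = X ^ 2
    P = X ^ 4

    P^ : ∀ N → P ^ N ≈ X ^ (N ℕ.* 4)
    P^ N = S.trans (^-assocʳ X 4 N) (S.reflexive (≡.cong (X ^_) (ℕ.*-comm 4 N)))

    P^² : ∀ N → P ^ (N ℕ.* 2) ≈ X ^ (N ℕ.* 4) * X ^ (N ℕ.* 4)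
    P^² N = S.trans (S.sym (^-assocʳ P N 2)) (S.trans
      (S.*-congˡ {P ^ N} (S.*-identityʳ (P ^ N))) (S.*-cong (P^ N) (P^ N)))

    p^ : ∀ N → p ^ (N ℕ.* 2) ≈ X ^ (N ℕ.* 4)
    p^ N = S.trans (^-assocʳ X 2 (N ℕ.* 2)) (S.reflexive (≡.cong (X ^_)
      (≡.trans (ℕ.*-comm 2 (N ℕ.* 2)) (ℕ.*-assoc N 2 2))))

    1-cong : ∀ {x y} → x ≈ y → 1# - x ≈ 1# - y
    1-cong x≈y = S.+-congˡ {1#} (S.-‿cong x≈y)

    pair : ∀ {x y z} s → x * y ≈ s → z ≈ s * s → (1# - (- x) * y) * (1# - s) ≈ 1# - z
    pair {x} {y} {z} s xy≈s z≈ss = S.trans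
      (S.*-congʳ {1# - s} (S.trans (1--x x y) (S.+-congˡ {1#} xy≈s)))
      (S.trans (difference-of-squares s) (1-cong (S.sym z≈ss)))

    -- For r = 1, 3 one has (1 + X^(4N+r))(1 - X^(4N+r)) = 1 - X^(8N+2r), two consecutive factors of
    -- (γ;P), while the exponents 4N + 2 and 4N + 4 give two factors of (p;p). This fixes the
    -- lengths N, 4N and 2N.
    finite : ∀ N → ⟨ - α ⨾ P ⟩ N * ⟨ - δ ⨾ P ⟩ N * ⟨ X ⨾ X ⟩ (N ℕ.* 4) ≈ ⟨ p ⨾ p ⟩ (N ℕ.* 2) * ⟨ γ ⨾ P ⟩ (N ℕ.* 2)
    finite zero = S.*-identityʳ (1# * 1#)
    finite (suc N) = euler-step {⟨ - α ⨾ P ⟩ N} {⟨ - δ ⨾ P ⟩ N} {⟨ X ⨾ X ⟩ (N ℕ.* 4)} {⟨ p ⨾ p ⟩ (N ℕ.* 2)} {⟨ γ ⨾ P ⟩ (N ℕ.* 2)}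
      (finite N)
      (pair {α} {P ^ N} {γ * P ^ (N ℕ.* 2)} (X * y)
        (S.trans (S.*-congˡ {α} (P^ N)) (solve 2 (λ x y → con 1 :* x :* y := x :* y) (λ _ → R.refl) X y))
        (S.trans (S.*-congˡ {γ} (P^² N))
          (solve 2 (λ x y → con 1 :* (x :* (x :* con 1)) :* (y :* y) := (x :* y) :* (x :* y)) (λ _ → R.refl) X y)))
      (pair {δ} {P ^ N} {γ * P ^ suc (N ℕ.* 2)} (X * (X * (X * y)))
        (S.trans (S.*-congˡ {δ} (P^ N)) (solve 2 (λ x y → con 1 :* (x :* (x :* (x :* con 1))) :* y := x :* (x :* (x :* y))) (λ _ → R.refl) X y))
        (S.trans (S.*-congˡ {γ} (S.*-congˡ {P} (P^² N)))
          (solve 2 (λ x y → con 1 :* (x :* (x :* con 1)) :* (x :* (x :* (x :* (x :* con 1))) :* (y :* y))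
             := (x :* (x :* (x :* y))) :* (x :* (x :* (x :* y)))) (λ _ → R.refl) X y)))
      (1-cong (S.trans (solve 2 (λ x y → x :* (x :* y) := x :* (x :* con 1) :* y) (λ _ → R.refl) X y) (S.*-congˡ {p} (S.sym (p^ N)))))
      (1-cong (S.trans (solve 2 (λ x y → x :* (x :* (x :* (x :* y))) := x :* (x :* con 1) :* (x :* (x :* con 1) :* y)) (λ _ → R.refl) X y)
        (S.*-congˡ {p} (S.*-congˡ {p} (S.sym (p^ N))))))
      where
      y : Carrier
      y = X ^ (N ℕ.* 4)

    limit : ∀ x y N M → y 0 R.≈ R.0# → N ℕ.≤ M → ⟨ x ⨾ y ⟩∞ ≡ ⟨ x ⨾ y ⟩ M [q^ N ]
    limit x y N M y₀ N≤M n n<N = R.sym (⟨⨾⟩∞-limit x y y₀ n M (ℕ.≤-trans n<N N≤M))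

  euler : ⟨ - α ⨾ P ⟩∞ * ⟨ - δ ⨾ P ⟩∞ * ⟨ X ⨾ X ⟩∞ ≈ ⟨ p ⨾ p ⟩∞ * ⟨ γ ⨾ P ⟩∞
  euler n = R.trans
    (*-cong-≡ {⟨ - α ⨾ P ⟩∞ * ⟨ - δ ⨾ P ⟩∞} {⟨ - α ⨾ P ⟩ N * ⟨ - δ ⨾ P ⟩ N}
      (*-cong-≡ {⟨ - α ⨾ P ⟩∞} (limit (- α) P N N P₀ ℕ.≤-refl) (limit (- δ) P N N P₀ ℕ.≤-refl))
      (limit X X N (N ℕ.* 4) R.refl (ℕ.m≤m*n N 4)) n ℕ.≤-refl)
    (R.trans (finite N n) (R.sym
      (*-cong-≡ {⟨ p ⨾ p ⟩∞} (limit p p N (N ℕ.* 2) (R.zeroˡ _) (ℕ.m≤m*n N 2)) (limit γ P N (N ℕ.* 2) P₀ (ℕ.m≤m*n N 2)) n ℕ.≤-refl)))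
    where
    N = suc n
    P₀ : P 0 R.≈ R.0#
    P₀ = R.zeroˡ _

-- The plain count.

module Specialised where
  open Colour
  open ℤ⟦q⟧
  open GeneratingFunction ℤ.+-*-commutativeRing (+ 1) (+ 1) (+ 1)
  open Fixpoint ℤ.+-*-commutativeRing using (*-cancel)
  open Euler ℤ.+-*-commutativeRing
  private
    module S = CommutativeRing commutativeRing
    open SetoidReasoning S.setoid
    open Solver S.commutativeSemiring

  -- By `euler`, multiplication by (q;q)∞ turns the numerator into the denominator, which then
  -- cancels.
  total-1/ : total ≈ 1# / ⟨ q ⨾ q ⟩∞
  total-1/ = *-cancel {⟨ q ⨾ q ⟩∞} {total} {1#} (⟨⨾⟩∞-constant q q ≡.refl) (begin
    total * Q                              ≈⟨ *-cancel {denominator} {total * Q} {denominator} denominator-constant total-Q ⟩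
    denominator * denominator ⁻¹           ≈⟨ ⁻¹-inverseʳ denominator denominator-constant ⟩
    1# ∎)
    where
    Q : Carrier
    Q = ⟨ q ⨾ q ⟩∞
    total-Q : total * Q * denominator ≈ denominator
    total-Q = S.trans (solve 3 (λ t x d → t :* x :* d := t :* d :* x) (λ _ → ≡.refl) total Q denominator)
      (S.trans (S.*-congʳ {Q} total-*) euler)

  open ListSum ℤ.+-*-commutativeRing monomial

  monomial≡1 : ∀ ps → monomial ps ≡ + 1
  monomial≡1 [] = ≡.refl
  monomial≡1 ((_ ▹ a) ∷ ps) = ≡.trans (ℤ.*-identityˡ _) (monomial≡1 ps)
  monomial≡1 ((_ ▹ b) ∷ ps) = ≡.trans (ℤ.*-identityˡ _) (monomial≡1 ps)
  monomial≡1 ((_ ▹ c) ∷ ps) = ≡.trans (ℤ.*-identityˡ _) (monomial≡1 ps)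
  monomial≡1 ((_ ▹ d) ∷ ps) = ≡.trans (ℤ.*-identityˡ _) (monomial≡1 ps)

  length≡Σ : ∀ pss → + length pss ≡ Σ pss
  length≡Σ []         = ≡.refl
  length≡Σ (ps ∷ pss) = ≡.cong₂ ℤ._+_ (≡.sym (monomial≡1 ps)) (length≡Σ pss)

  A₂-total-gf : (λ n → + A₂-total n) ≈ 1# / ⟨ q ⨾ q ⟩∞
  A₂-total-gf n = ≡.trans (length≡Σ (elements (admissibleOf n))) (total-1/ n)

-- Extracting the coefficients in a, c and d for the refined count.

-- single i k x is the coefficient of Xᵏ in x Xⁱ.
single : ℕ → ℕ → ℤ → ℤ
single zero    zero    x = x
single zero    (suc k) x = + 0
single (suc i) zero    x = + 0
single (suc i) (suc k) x = single i k x

single-≡ : ∀ i x → single i i x ≡ x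
single-≡ zero    x = ≡.refl
single-≡ (suc i) x = single-≡ i x

single-≢ : ∀ i k x → i ≢ k → single i k x ≡ + 0
single-≢ zero    zero    x i≢k = ⊥-elim (i≢k ≡.refl)
single-≢ zero    (suc k) x i≢k = ≡.refl
single-≢ (suc i) zero    x i≢k = ≡.refl
single-≢ (suc i) (suc k) x i≢k = single-≢ i k x (λ i≡k → i≢k (≡.cong suc i≡k))

single-0 : ∀ i k → single i k (+ 0) ≡ + 0
single-0 zero    zero    = ≡.refl
single-0 zero    (suc k) = ≡.refl
single-0 (suc i) zero    = ≡.refl
single-0 (suc i) (suc k) = single-0 i k

module Refined where
  open Colour
  private
    module Dr = PowerSeries ℤ.+-*-commutativeRing
    module Cr = PowerSeries Dr.commutativeRing
    module Ar = PowerSeries Cr.commutativeRing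
    module D = SeriesProperties ℤ.+-*-commutativeRing
    module C = SeriesProperties Dr.commutativeRing
    module A = SeriesProperties Cr.commutativeRing
  open GeneratingFunction Ar.commutativeRing Ar.X (Ar.const Cr.X) (Ar.const (Cr.const Dr.X)) public
  open ListSum Ar.commutativeRing monomial

  -- The monomial a^i c^j d^r as an element of the nested series ring, read at the exponents k, ℓ,
  -- m.
  coefficient : ℕ → ℕ → ℕ → Ar.Carrier
  coefficient i j r k ℓ m = single i k (single j ℓ (single r m (+ 1)))

  coefficient-≢ : ∀ i j r k ℓ m → ¬ (i ≡ k × j ≡ ℓ × r ≡ m) → coefficient i j r k ℓ m ≡ + 0
  coefficient-≢ i j r k ℓ m ≢ with i ℕ.≟ k | j ℕ.≟ ℓ | r ℕ.≟ m
  ... | no i≢k     | _          | _          = single-≢ i k _ i≢k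
  ... | yes _      | no j≢ℓ     | _          = ≡.trans (≡.cong (single i k) (single-≢ j ℓ _ j≢ℓ)) (single-0 i k)
  ... | yes _      | yes _      | no r≢m     = ≡.trans (≡.cong (λ x → single i k (single j ℓ x)) (single-≢ r m _ r≢m))
                                                 (≡.trans (≡.cong (single i k) (single-0 j ℓ)) (single-0 i k))
  ... | yes i≡k | yes j≡ℓ | yes r≡m = ⊥-elim (≢ (i≡k , j≡ℓ , r≡m))

  coefficient-≡ : ∀ i j r → coefficient i j r i j r ≡ + 1
  coefficient-≡ i j r = ≡.trans (single-≡ i _) (≡.trans (single-≡ j _) (single-≡ r _))

  a* : ∀ i j r → Ar._≈_ (Ar._*_ Ar.X (coefficient i j r)) (coefficient (suc i) j r)
  a* i j r zero    ℓ m = A.X*-zero (coefficient i j r) ℓ m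
  a* i j r (suc k) ℓ m = A.X*-suc (coefficient i j r) k ℓ m

  c* : ∀ i j r → Ar._≈_ (Ar._*_ (Ar.const Cr.X) (coefficient i j r)) (coefficient i (suc j) r)
  c* i j r k ℓ m = ≡.trans (A.const* Cr.X (coefficient i j r) k ℓ m) (go ℓ)
    where
    go : ∀ ℓ → (Cr._*_ Cr.X (coefficient i j r k)) ℓ m ≡ coefficient i (suc j) r k ℓ m
    go zero    = ≡.trans (C.X*-zero (coefficient i j r k) m) (≡.sym (single-0 i k))
    go (suc ℓ) = C.X*-suc (coefficient i j r k) ℓ m

  d* : ∀ i j r → Ar._≈_ (Ar._*_ (Ar.const (Cr.const Dr.X)) (coefficient i j r)) (coefficient i j (suc r))
  d* i j r k ℓ m = ≡.trans (A.const* (Cr.const Dr.X) (coefficient i j r) k ℓ m)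
    (≡.trans (C.const* Dr.X (coefficient i j r k) ℓ m) (go m))
    where
    go : ∀ m → (Dr._*_ Dr.X (coefficient i j r k ℓ)) m ≡ coefficient i j (suc r) k ℓ m
    go zero    = ≡.trans (D.X*-zero (coefficient i j r k ℓ)) (≡.sym (≡.trans (≡.cong (single i k) (single-0 j ℓ)) (single-0 i k)))
    go (suc m) = D.X*-suc (coefficient i j r k ℓ) m

  private
    module S = CommutativeRing Ar.commutativeRing

  monomial-coefficient : ∀ ps → Ar._≈_ (monomial ps) (coefficient (#[ a ] ps) (#[ c ] ps) (#[ d ] ps))
  monomial-coefficient [] zero    zero    zero    = ≡.refl
  monomial-coefficient [] zero    zero    (suc m) = ≡.refl
  monomial-coefficient [] zero    (suc ℓ) m       = ≡.refl
  monomial-coefficient [] (suc k) ℓ       m       = ≡.refl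
  monomial-coefficient ((_ ▹ a) ∷ ps) = S.trans (S.*-congˡ {Ar.X} (monomial-coefficient ps)) (a* (#[ a ] ps) (#[ c ] ps) (#[ d ] ps))
  monomial-coefficient ((_ ▹ b) ∷ ps) = S.trans (S.*-identityˡ (monomial ps)) (monomial-coefficient ps)
  monomial-coefficient ((_ ▹ c) ∷ ps) = S.trans (S.*-congˡ {Ar.const Cr.X} (monomial-coefficient ps)) (c* (#[ a ] ps) (#[ c ] ps) (#[ d ] ps))
  monomial-coefficient ((_ ▹ d) ∷ ps) = S.trans (S.*-congˡ {Ar.const (Cr.const Dr.X)} (monomial-coefficient ps)) (d* (#[ a ] ps) (#[ c ] ps) (#[ d ] ps))

  -- Each sequence contributes 1 to the coefficient if its colour counts are k, ℓ, m, and 0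
  -- otherwise. As all entries are admissible, failing the type means failing one of the counts.
  length-filter≡Σ : ∀ n k ℓ m {pss} → All (AdmissibleOf n) pss →
                    + length (filter (admissibleOfType? n k ℓ m) pss) ≡ Σ pss k ℓ m
  length-filter≡Σ n k ℓ m [] = ≡.refl
  length-filter≡Σ n k ℓ m (_∷_ {ps} {pss} adm adms) = by (type? ps)
    where
    type? : Decidable (AdmissibleOfType n k ℓ m)
    type? = admissibleOfType? n k ℓ m
    by : Dec (AdmissibleOfType n k ℓ m ps) → + length (filter type? (ps ∷ pss)) ≡ Σ (ps ∷ pss) k ℓ m
    -- Matching on the equations puts the actual colour counts for k, ℓ and m, so `coefficient-≡`
    -- applies.
    by (yes type@(_ , ≡.refl , ≡.refl , ≡.refl)) = ≡.trans
      (≡.cong (λ xs → + length xs) (filter-accept type? {xs = pss} type))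
      (≡.cong₂ ℤ._+_ (≡.sym (≡.trans (monomial-coefficient ps k ℓ m) (coefficient-≡ k ℓ m))) (length-filter≡Σ n k ℓ m adms))
    by (no ¬type) = ≡.trans
      (≡.cong (λ xs → + length xs) (filter-reject type? {xs = pss} ¬type))
      (≡.trans (≡.sym (ℤ.+-identityˡ _)) (≡.cong₂ ℤ._+_
        (≡.sym (≡.trans (monomial-coefficient ps k ℓ m)
          (coefficient-≢ (#[ a ] ps) (#[ c ] ps) (#[ d ] ps) k ℓ m (λ eqs → ¬type (adm , eqs)))))
        (length-filter≡Σ n k ℓ m adms)))

  A₂≡total : ∀ n k ℓ m → + A₂ n k ℓ m ≡ total n k ℓ m
  A₂≡total n k ℓ m = length-filter≡Σ n k ℓ m (All.tabulate (sound (admissibleOf n)))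

theorem2p6 : (let open ℤ⟦a,c,d⟧⟦q⟧ in
    (λ n k ℓ m → + A₂ n k ℓ m)
    ≈ (⟨ - (a * q) ⨾ q ^ 4 ⟩∞ * ⟨ - (d * q ^ 3) ⨾ q ^ 4 ⟩∞)
    / (⟨ q ^ 2 ⨾ q ^ 2 ⟩∞ * ⟨ c * q ^ 2 ⨾ q ^ 4 ⟩∞))
    ×
    (let open ℤ⟦q⟧ in
    (λ n → + A₂-total n) ≈ 1# / ⟨ q ⨾ q ⟩∞)
theorem2p6 = (λ n k ℓ m → ≡.trans (Refined.A₂≡total n k ℓ m) (Refined.total-/ n k ℓ m)) , Specialised.A₂-total-gf
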